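{- Let $T(z,w)=\sum_{n\ge1}\sum_{t\ge0}T(n,t)\,w^t z^n$. Define $\psi_0(z)=1-2z(1-w)$, $\psi_1(z)=\sqrt{1-4z(1-w)}$, and $\psi_j(z)=\sqrt{2\psi_{j-1}(z)-1}$ for $j\ge2$. Then $$T(z,w)=\sum_{j\ge0}\frac{\psi_j(z)-\psi_{j+1}(z)}{2z(1-w)}\,w^j.$$
   Context: Multi-pass stack sorting: in a pass, the entries of the current input are pushed one at a time, in order, onto a stack; whenever the top of the stack is the smallest value not yet output, it is popped to the output (repeatedly); entries are never popped otherwise. When all input entries have been pushed and no pop is possible, if the stack is nonempty the remaining entries are returned to the input in their original relative order and a new pass begins. The tier of a permutation is one less than the minimum number of passes needed to output $1,\dots,n$. $T(n,t)$ denotes the number of permutations of length $n$ with tier $t$. Square roots denote the formal power series with constant term $1$. -}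

module Defs where

open import Data.Bool using (Bool; true; false; _∧_; not; if_then_else_)
open import Data.Nat as ℕ using (ℕ; zero; suc; _∸_; _≡ᵇ_)
import Data.Nat.Properties as ℕₚ
open import Data.List using (List; []; _∷_; length; reverse; concatMap; map; filterᵇ)
open import Data.Bool.ListAction using (any)
open import Data.Product using (_×_; _,_)
open import Data.Integer using (+_)
open import Data.Rational using (ℚ; 0ℚ; 1ℚ; ½; _+_; _*_; _-_; _/_)

-- Pop the stack while its top equals k (the smallest value not yet
-- output); returns the new stack and the new k.
popWhile : List ℕ → ℕ → List ℕ × ℕ
popWhile [] k = [] , k
popWhile (y ∷ ys) k = if y ≡ᵇ k then popWhile ys (suc k) else (y ∷ ys , k)

pushAll : List ℕ → List ℕ → ℕ → List ℕ × ℕ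
pushAll [] st k = st , k
pushAll (x ∷ xs) st k with popWhile (x ∷ st) k
... | st' , k' = pushAll xs st' k'

-- One pass: the remaining stack entries are returned to the input in
-- their original relative order (the reverse of the stack order).
pass : List ℕ → ℕ → List ℕ × ℕ
pass inp k with pushAll inp [] k
... | st , k' = reverse st , k'

-- Number of passes performed until the input is exhausted (fuel bounds
-- the number of passes; each pass outputs at least one entry, so fuel n
-- suffices for a permutation of length n).
passesFrom : ℕ → List ℕ → ℕ → ℕ
passesFrom zero _ _ = zero
passesFrom (suc f) [] _ = zero
passesFrom (suc f) (x ∷ xs) k with pass (x ∷ xs) k
... | inp' , k' = suc (passesFrom f inp' k')

passes : List ℕ → ℕ
passes π = passesFrom (length π) π 1

tier : List ℕ → ℕ
tier π = passes π ∸ 1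

oneToN : ℕ → List ℕ
oneToN zero = []
oneToN (suc n) = oneToN n Data.List.++ (suc n ∷ [])

wordsOver : List ℕ → ℕ → List (List ℕ)
wordsOver A zero = [] ∷ []
wordsOver A (suc k) = concatMap (λ a → map (a ∷_) (wordsOver A k)) A

distinct : List ℕ → Bool
distinct [] = true
distinct (x ∷ xs) = not (any (λ y → x ≡ᵇ y) xs) ∧ distinct xs

perms : ℕ → List (List ℕ)
perms n = filterᵇ distinct (wordsOver (oneToN n) n)

T : ℕ → ℕ → ℕ
T n t = length (filterᵇ (λ π → tier π ≡ᵇ t) (perms n))

-- Formal power series in z and w over ℚ:  F n t = [z^n w^t] F.

Series : Set
Series = ℕ → ℕ → ℚ

sumTo : ℕ → (ℕ → ℚ) → ℚ
sumTo zero f = f zero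
sumTo (suc n) f = sumTo n f + f (suc n)

fromℕℚ : ℕ → ℚ
fromℕℚ n = + n / 1

const : ℚ → Series
const c zero zero = c
const c _ _ = 0ℚ

zS : Series
zS (suc zero) zero = 1ℚ
zS _ _ = 0ℚ

wS : Series
wS zero (suc zero) = 1ℚ
wS _ _ = 0ℚ

_⊕_ : Series → Series → Series
(F ⊕ G) n t = F n t + G n t

_⊖_ : Series → Series → Series
(F ⊖ G) n t = F n t - G n t

_⊛_ : Series → Series → Series
(F ⊛ G) n t = sumTo n (λ i → sumTo t (λ j → F i j * G (n ∸ i) (t ∸ j)))

scale : ℚ → Series → Series
scale c F n t = c * F n t

infixl 6 _⊕_ _⊖_
infixl 7 _⊛_

pow : Series → ℕ → Series
pow F zero = const 1ℚ
pow F (suc k) = F ⊛ pow F k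

halfChoose : ℕ → ℚ
halfChoose zero = 1ℚ
halfChoose (suc k) = halfChoose k * (½ - fromℕℚ k) * (+ 1 / suc k)

-- Square root of a series with constant term 1 (the formal power series
-- with constant term 1):  √(1+X) = Σ_k (1/2 choose k) X^k, X = F - 1.
-- Since X has zero constant term, only k ≤ n+t contribute to [z^n w^t].
sqrtS : Series → Series
sqrtS F n t = sumTo (n ℕ.+ t) (λ k → halfChoose k * pow (F ⊖ const 1ℚ) k n t)

-- Inverse of a series with constant term 1:  1/(1-Y) = Σ_k Y^k, Y = 1 - F.
invS : Series → Series
invS F n t = sumTo (n ℕ.+ t) (λ k → pow (const 1ℚ ⊖ F) k n t)

-- Division by z (exact for series whose z^0 coefficients all vanish).
divZ : Series → Series
divZ F n t = F (suc n) t

-- Σ_{j≥0} G_j w^j (well defined as a formal power series).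
wSum : (ℕ → Series) → Series
wSum G n t = sumTo t (λ j → G j n (t ∸ j))

Tgf : Series
Tgf zero t = 0ℚ
Tgf (suc n) t = fromℕℚ (T (suc n) t)

oneMinusW : Series
oneMinusW = const 1ℚ ⊖ wS

ψ : ℕ → Series
ψ zero = const 1ℚ ⊖ scale (fromℕℚ 2) (zS ⊛ oneMinusW)
ψ (suc zero) = sqrtS (const 1ℚ ⊖ scale (fromℕℚ 4) (zS ⊛ oneMinusW))
ψ (suc (suc j)) = sqrtS (scale (fromℕℚ 2) (ψ (suc j)) ⊖ const 1ℚ)

term : ℕ → Series
term j = scale ½ (invS oneMinusW ⊛ divZ (ψ j ⊖ ψ (suc j)))

{-# OPTIONS --safe #-}
module Submission where

-- Build a permutation by inserting n, n-1, …, 1 in turn.  Inserting a new minimum leaves the number of passes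
-- unchanged if it lands at most one place behind the previous minimum, and otherwise costs exactly one
-- additional pass that outputs nothing else.  So the tier counts the steps p ↦ q with q ≥ p + 2 of the position
-- of the minimum.
--
-- Dividing the tier polynomial by (1-w)^(n+1) amounts to counting insertion sequences whose steps carry weakly
-- increasing levels that strictly increase at every costly step.  With levels 0, …, m-1 their generating
-- function φ_m (shifted by one) satisfies φ_0 = u and φ_m = φ_{m-1} + φ_m²; hence 1 - 2φ_m is obtained from
-- 1 - 2φ_{m-1} by x ↦ √(2x - 1), and the substitution u = z(1-w) turns it into ψ_m.

open import Defs
open import Algebra using (CommutativeRing)
open import Data.Bool as Bool using (Bool; true; false; if_then_else_; not)
open import Data.Bool.ListAction using (any)
open import Data.Empty using (⊥-elim)
open import Data.Nat as ℕ using (ℕ; zero; suc; _∸_; z≤n; s≤s)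
import Data.Nat.Properties as ℕₚ
open import Data.Product using (_×_; _,_; proj₁; proj₂; uncurry; ∃)
open import Data.Sum using (inj₁; inj₂)
open import Relation.Binary.PropositionalEquality as ≡ using (_≡_)

-- A distant insertion is costly because the entries in between bury the old minimum: when the new
-- one is popped, the old one is in the stack but not on top, so the pass merely returns the
-- previous list.
--
-- A sequence of n insertions of cost c contributes w^c / (1-w)^(n+1) once w marks the highest level
-- allowed; this is the source of the division. On the side of the ψ_j, the substitution turns
-- u^(n+1) into z^(n+1) (1-w)^(n+1), the denominator z(1-w) takes one factor 1-w away, and summation
-- by parts over the differences φ_(j+1) - φ_j restores it.
--
-- The obstacle is the quadratic equation for φ_m: the recursion for insertion sequences involves
-- the length k and the position p of the minimum and is not closed at k = p = 0. The equation is
-- therefore read off from a product formula for arbitrary k and p, whose instance k = p = 0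
-- evaluates φ_m².

≤ᵇ-true : ∀ {i p} → i ℕ.≤ p → (i ℕ.≤ᵇ p) ≡ true
≤ᵇ-true {i} {p} i≤p with i ℕ.≤ᵇ p | ℕₚ.≤⇒≤ᵇ i≤p
... | true | _ = ≡.refl

≤ᵇ-false : ∀ {i p} → p ℕ.< i → (i ℕ.≤ᵇ p) ≡ false
≤ᵇ-false {i} {p} p<i with i ℕ.≤ᵇ p | ℕₚ.≤ᵇ⇒≤ i p
... | false | _ = ≡.refl
... | true | i≤p = ⊥-elim (ℕₚ.<⇒≱ p<i (i≤p _))

-- Formal power series over a commutative ring

module FiniteSums {c ℓ} (R : CommutativeRing c ℓ) where
  open CommutativeRing R hiding (zero)
  open import Relation.Binary.Reasoning.Setoid setoid
  open import Algebra.Properties.CommutativeSemigroup +-commutativeSemigroup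
    using () renaming (interchange to +-medial)

  Σ≤ : ℕ → (ℕ → Carrier) → Carrier
  Σ≤ zero f = f zero
  Σ≤ (suc n) f = Σ≤ n f + f (suc n)

  Σ≤-cong : ∀ n {f g : ℕ → Carrier} → (∀ i → i ℕ.≤ n → f i ≈ g i) → Σ≤ n f ≈ Σ≤ n g
  Σ≤-cong zero f≈g = f≈g 0 z≤n
  Σ≤-cong (suc n) f≈g =
    +-cong (Σ≤-cong n λ i i≤n → f≈g i (ℕₚ.m≤n⇒m≤1+n i≤n)) (f≈g (suc n) ℕₚ.≤-refl)

  Σ≤-0 : ∀ n → Σ≤ n (λ _ → 0#) ≈ 0#
  Σ≤-0 zero = refl
  Σ≤-0 (suc n) = trans (+-congʳ (Σ≤-0 n)) (+-identityˡ 0#)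

  Σ≤-+ : ∀ n (f g : ℕ → Carrier) → Σ≤ n (λ i → f i + g i) ≈ Σ≤ n f + Σ≤ n g
  Σ≤-+ zero f g = refl
  Σ≤-+ (suc n) f g = trans (+-congʳ (Σ≤-+ n f g)) (+-medial _ _ _ _)

  Σ≤-*ˡ : ∀ n a (f : ℕ → Carrier) → a * Σ≤ n f ≈ Σ≤ n (λ i → a * f i)
  Σ≤-*ˡ zero a f = refl
  Σ≤-*ˡ (suc n) a f = trans (distribˡ a _ _) (+-congʳ (Σ≤-*ˡ n a f))

  Σ≤-suc : ∀ n (f : ℕ → Carrier) → Σ≤ (suc n) f ≈ f 0 + Σ≤ n (λ i → f (suc i))
  Σ≤-suc zero f = refl
  Σ≤-suc (suc n) f = trans (+-congʳ (Σ≤-suc n f)) (+-assoc _ _ _)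

  Σ≤-extend : ∀ n m {f : ℕ → Carrier} → n ℕ.≤ m → (∀ i → n ℕ.< i → f i ≈ 0#) → Σ≤ m f ≈ Σ≤ n f
  Σ≤-extend n m n≤m z with ℕₚ.m≤n⇒m<n∨m≡n n≤m
  Σ≤-extend n m n≤m z | inj₂ ≡.refl = refl
  Σ≤-extend n (suc m) n≤m z | inj₁ (s≤s n≤m′) =
    trans (+-cong (Σ≤-extend n m n≤m′ z) (z (suc m) (s≤s n≤m′))) (+-identityʳ _)

module PowerSeries {c ℓ} (R : CommutativeRing c ℓ) where
  open CommutativeRing R hiding (zero)
  open FiniteSums R
  open import Relation.Binary.Reasoning.Setoid setoid
  open import Algebra.Properties.CommutativeSemigroup +-commutativeSemigroup
    using () renaming (interchange to +-medial; x∙yz≈y∙xz to +-left-comm)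

  PS : Set c
  PS = ℕ → Carrier

  infix 4 _≋_
  _≋_ : PS → PS → Set ℓ
  f ≋ g = ∀ n → f n ≈ g n

  infixl 7 _⋆_ _·_
  _⋆_ : PS → PS → PS
  (f ⋆ g) n = Σ≤ n λ i → f i * g (n ∸ i)

  _·_ : Carrier → PS → PS
  (a · f) n = a * f n

  infixl 6 _⊞_
  _⊞_ : PS → PS → PS
  (f ⊞ g) n = f n + g n

  tail : PS → PS
  tail f n = f (suc n)

  C : Carrier → PS
  C a zero = a
  C a (suc n) = 0#

  ⋆-local : ∀ n {f f′ g g′ : PS} → (∀ i → i ℕ.≤ n → f i ≈ f′ i) → (∀ i → i ℕ.≤ n → g i ≈ g′ i) →
            (f ⋆ g) n ≈ (f′ ⋆ g′) n
  ⋆-local n f≈ g≈ = Σ≤-cong n λ i i≤n → *-cong (f≈ i i≤n) (g≈ (n ∸ i) (ℕₚ.m∸n≤m n i))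

  ⋆-cong : ∀ {f f′ g g′} → f ≋ f′ → g ≋ g′ → f ⋆ g ≋ f′ ⋆ g′
  ⋆-cong f≈ g≈ n = ⋆-local n (λ i _ → f≈ i) (λ i _ → g≈ i)

  ⋆-suc : ∀ f g n → (f ⋆ g) (suc n) ≈ f 0 * g (suc n) + (tail f ⋆ g) n
  ⋆-suc f g n = Σ≤-suc n _

  ⋆-sucʳ : ∀ f g n → (f ⋆ g) (suc n) ≈ f (suc n) * g 0 + (f ⋆ tail g) n
  ⋆-sucʳ f g zero = +-comm _ _
  ⋆-sucʳ f g (suc n) = begin
    (f ⋆ g) (suc (suc n))                                        ≈⟨ ⋆-suc f g (suc n) ⟩
    f 0 * g (suc (suc n)) + (tail f ⋆ g) (suc n)                 ≈⟨ +-congˡ (⋆-sucʳ (tail f) g n) ⟩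
    f 0 * g (suc (suc n)) + (f (suc (suc n)) * g 0 + (tail f ⋆ tail g) n)
      ≈⟨ +-left-comm _ _ _ ⟩
    f (suc (suc n)) * g 0 + (f 0 * g (suc (suc n)) + (tail f ⋆ tail g) n)
      ≈⟨ +-congˡ (⋆-suc f (tail g) n) ⟨
    f (suc (suc n)) * g 0 + (f ⋆ tail g) (suc n)                 ∎

  ⋆-comm : ∀ f g → f ⋆ g ≋ g ⋆ f
  ⋆-comm f g zero = *-comm _ _
  ⋆-comm f g (suc n) = begin
    (f ⋆ g) (suc n)                  ≈⟨ ⋆-suc f g n ⟩
    f 0 * g (suc n) + (tail f ⋆ g) n ≈⟨ +-cong (*-comm _ _) (⋆-comm (tail f) g n) ⟩
    g (suc n) * f 0 + (g ⋆ tail f) n ≈⟨ ⋆-sucʳ g f n ⟨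
    (g ⋆ f) (suc n)                  ∎

  ⋆-distribʳ : ∀ h f g → (f ⊞ g) ⋆ h ≋ (f ⋆ h) ⊞ (g ⋆ h)
  ⋆-distribʳ h f g n = trans (Σ≤-cong n λ i _ → distribʳ _ _ _) (Σ≤-+ n _ _)

  ⋆-distribˡ : ∀ h f g → h ⋆ (f ⊞ g) ≋ (h ⋆ f) ⊞ (h ⋆ g)
  ⋆-distribˡ h f g n = trans (Σ≤-cong n λ i _ → distribˡ _ _ _) (Σ≤-+ n _ _)

  ·-⋆-assoc : ∀ a f g → (a · f) ⋆ g ≋ a · (f ⋆ g)
  ·-⋆-assoc a f g n = trans (Σ≤-cong n λ i _ → *-assoc _ _ _) (sym (Σ≤-*ˡ n a _))

  ⋆-· : ∀ a f g → f ⋆ (a · g) ≋ a · (f ⋆ g)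
  ⋆-· a f g n = trans (⋆-comm f (a · g) n) (trans (·-⋆-assoc a g f n) (*-congˡ (⋆-comm g f n)))

  ⋆-assoc : ∀ f g h → (f ⋆ g) ⋆ h ≋ f ⋆ (g ⋆ h)
  ⋆-assoc f g h zero = *-assoc _ _ _
  ⋆-assoc f g h (suc n) = begin
    ((f ⋆ g) ⋆ h) (suc n)
      ≈⟨ ⋆-suc (f ⋆ g) h n ⟩
    f 0 * g 0 * h (suc n) + (tail (f ⋆ g) ⋆ h) n
      ≈⟨ +-cong (*-assoc _ _ _) (⋆-cong {g = h} (⋆-suc f g) (λ _ → refl) n) ⟩
    f 0 * (g 0 * h (suc n)) + ((f 0 · tail g ⊞ tail f ⋆ g) ⋆ h) n
      ≈⟨ +-congˡ (⋆-distribʳ h _ _ n) ⟩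
    f 0 * (g 0 * h (suc n)) + (((f 0 · tail g) ⋆ h) n + ((tail f ⋆ g) ⋆ h) n)
      ≈⟨ +-congˡ (+-cong (·-⋆-assoc (f 0) (tail g) h n) (⋆-assoc (tail f) g h n)) ⟩
    f 0 * (g 0 * h (suc n)) + (f 0 * (tail g ⋆ h) n + (tail f ⋆ (g ⋆ h)) n)
      ≈⟨ +-assoc _ _ _ ⟨
    f 0 * (g 0 * h (suc n)) + f 0 * (tail g ⋆ h) n + (tail f ⋆ (g ⋆ h)) n
      ≈⟨ +-congʳ (trans (*-congˡ (⋆-suc g h n)) (distribˡ _ _ _)) ⟨
    f 0 * (g ⋆ h) (suc n) + (tail f ⋆ (g ⋆ h)) n
      ≈⟨ ⋆-suc f (g ⋆ h) n ⟨
    (f ⋆ (g ⋆ h)) (suc n) ∎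

  ⋆-zeroˡ : ∀ f → (λ _ → 0#) ⋆ f ≋ λ _ → 0#
  ⋆-zeroˡ f n = trans (Σ≤-cong n λ i _ → zeroˡ _) (Σ≤-0 n)

  C-⋆ : ∀ a f → C a ⋆ f ≋ a · f
  C-⋆ a f zero = refl
  C-⋆ a f (suc n) = trans (⋆-suc (C a) f n) (trans (+-congˡ (⋆-zeroˡ f n)) (+-identityʳ _))

  -- Packaging the series as a ring allows iteration: over ℚ this is ℚ[[w]], and over ℚ[[w]] it is
  -- the ring of series in z in which the theorem lives.
  PS-commutativeRing : CommutativeRing c ℓ
  PS-commutativeRing = record
    { Carrier = PS
    ; _≈_ = _≋_
    ; _+_ = _⊞_
    ; _*_ = _⋆_
    ; -_ = λ f n → - f n
    ; 0# = λ _ → 0#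
    ; 1# = C 1#
    ; isCommutativeRing = record
      { isRing = record
        { +-isAbelianGroup = record
          { isGroup = record
            { isMonoid = record
              { isSemigroup = record
                { isMagma = record
                  { isEquivalence = record
                    { refl = λ _ → refl
                    ; sym = λ f≈g n → sym (f≈g n)
                    ; trans = λ f≈g g≈h n → trans (f≈g n) (g≈h n) }
                  ; ∙-cong = λ f≈ g≈ n → +-cong (f≈ n) (g≈ n) }
                ; assoc = λ f g h n → +-assoc _ _ _ }
              ; identity = (λ f n → +-identityˡ _) , (λ f n → +-identityʳ _) }
            ; inverse = (λ f n → -‿inverseˡ _) , (λ f n → -‿inverseʳ _)
            ; ⁻¹-cong = λ f≈ n → -‿cong (f≈ n) }
          ; comm = λ f g n → +-comm _ _ }
        ; *-cong = ⋆-cong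
        ; *-assoc = ⋆-assoc
        ; *-identity = identityˡ , λ f n → trans (⋆-comm f (C 1#) n) (identityˡ f n)
        ; distrib = ⋆-distribˡ , ⋆-distribʳ }
      ; *-comm = ⋆-comm } }
    where
    identityˡ : ∀ f → C 1# ⋆ f ≋ f
    identityˡ f n = trans (C-⋆ 1# f n) (*-identityˡ _)

  -- The coefficient `f n` only meets `X 0`. This gain of one order takes the place of every
  -- convergence argument below.
  ⋆-contract : ∀ {X f g : PS} → X 0 ≈ 0# → ∀ n → (∀ i → i ℕ.< n → f i ≈ g i) → (X ⋆ f) n ≈ (X ⋆ g) n
  ⋆-contract X₀ zero f≈g = trans (*-congʳ X₀) (trans (zeroˡ _) (sym (trans (*-congʳ X₀) (zeroˡ _))))
  ⋆-contract {X} {f} {g} X₀ (suc n) f≈g = begin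
    (X ⋆ f) (suc n)                  ≈⟨ ⋆-suc X f n ⟩
    X 0 * f (suc n) + (tail X ⋆ f) n ≈⟨ +-cong (trans (*-congʳ X₀) (zeroˡ _))
                                           (⋆-local n {f = tail X} (λ _ _ → refl) λ i i≤n → f≈g i (s≤s i≤n)) ⟩
    0# + (tail X ⋆ g) n              ≈⟨ +-congʳ (trans (*-congʳ X₀) (zeroˡ _)) ⟨
    X 0 * g (suc n) + (tail X ⋆ g) n ≈⟨ ⋆-suc X g n ⟨
    (X ⋆ g) (suc n)                  ∎

  module Substitution (X : PS) (X₀ : X 0 ≈ 0#) where

    power : ℕ → PS
    power zero = C 1#
    power (suc k) = X ⋆ power k

    power-vanish : ∀ k n → n ℕ.< k → power k n ≈ 0#
    power-vanish (suc k) n (s≤s n≤k) = trans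
      (⋆-contract X₀ n λ i i<n → power-vanish k i (ℕₚ.<-≤-trans i<n n≤k))
      (trans (⋆-comm X _ n) (⋆-zeroˡ X n))

    -- The composite h(X). Cutting off at k = n loses nothing, since X^k vanishes below order k.
    ev : PS → PS
    ev h n = Σ≤ n λ k → h k * power k n

    ev-extend : ∀ h n m → n ℕ.≤ m → Σ≤ m (λ k → h k * power k n) ≈ ev h n
    ev-extend h n m n≤m = Σ≤-extend n m n≤m λ k n<k → trans (*-congˡ (power-vanish k n n<k)) (zeroʳ _)

    ev-cong : ∀ {h g} → h ≋ g → ev h ≋ ev g
    ev-cong h≈g n = Σ≤-cong n λ k _ → *-congʳ (h≈g k)

    ev-+ : ∀ h g → ev (h ⊞ g) ≋ ev h ⊞ ev g
    ev-+ h g n = trans (Σ≤-cong n λ k _ → distribʳ _ _ _) (Σ≤-+ n _ _)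

    ev-· : ∀ a h → ev (a · h) ≋ a · ev h
    ev-· a h n = trans (Σ≤-cong n λ k _ → *-assoc _ _ _) (sym (Σ≤-*ˡ n a _))

    ⋆-Σ≤ : ∀ m (f : PS) (F : ℕ → PS) → (f ⋆ λ i → Σ≤ m λ k → F k i) ≋ λ n → Σ≤ m λ k → (f ⋆ F k) n
    ⋆-Σ≤ zero f F n = refl
    ⋆-Σ≤ (suc m) f F n = trans (⋆-distribˡ f (λ i → Σ≤ m λ k → F k i) (F (suc m)) n) (+-congʳ (⋆-Σ≤ m f F n))

    ev-unfold : ∀ h → ev h ≋ C (h 0) ⊞ X ⋆ ev (tail h)
    ev-unfold h zero = trans (*-identityʳ _)
      (sym (trans (+-congˡ (trans (*-congʳ X₀) (zeroˡ _))) (+-identityʳ _)))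
    ev-unfold h (suc n) = begin
      ev h (suc n)
        ≈⟨ Σ≤-suc n _ ⟩
      h 0 * 0# + Σ≤ n (λ k → h (suc k) * (X ⋆ power k) (suc n))
        ≈⟨ +-cong (zeroʳ _) (Σ≤-cong n λ k _ → sym (⋆-· (h (suc k)) X (power k) (suc n))) ⟩
      0# + Σ≤ n (λ k → (X ⋆ (h (suc k) · power k)) (suc n))
        ≈⟨ +-congˡ (⋆-Σ≤ n X (λ k → h (suc k) · power k) (suc n)) ⟨
      0# + (X ⋆ (λ i → Σ≤ n λ k → h (suc k) * power k i)) (suc n)
        ≈⟨ +-congˡ (⋆-contract X₀ (suc n) λ { i (s≤s i≤n) → ev-extend (tail h) i n i≤n }) ⟩
      0# + (X ⋆ ev (tail h)) (suc n) ∎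

    -- Since ev h = h₀ + X · ev (tail h) and multiplication by X gains one order of precision, agreement up to
    -- order n propagates to order n + 1.
    ev-⋆-below : ∀ n h g i → i ℕ.< n → (ev h ⋆ ev g) i ≈ ev (h ⋆ g) i
    ev-⋆-below (suc n) h g i (s≤s i≤n) = begin
      (ev h ⋆ ev g) i
        ≈⟨ ⋆-cong {g = ev g} (ev-unfold h) (λ _ → refl) i ⟩
      ((C (h 0) ⊞ X ⋆ ev (tail h)) ⋆ ev g) i
        ≈⟨ ⋆-distribʳ (ev g) (C (h 0)) (X ⋆ ev (tail h)) i ⟩
      (C (h 0) ⋆ ev g) i + ((X ⋆ ev (tail h)) ⋆ ev g) i
        ≈⟨ +-cong (C-⋆ (h 0) (ev g) i) (⋆-assoc X (ev (tail h)) (ev g) i) ⟩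
      h 0 * ev g i + (X ⋆ (ev (tail h) ⋆ ev g)) i
        ≈⟨ +-cong (*-congˡ (ev-unfold g i))
             (⋆-contract X₀ i λ j j<i → ev-⋆-below n (tail h) g j (ℕₚ.<-≤-trans j<i i≤n)) ⟩
      h 0 * (C (g 0) i + (X ⋆ ev (tail g)) i) + (X ⋆ ev (tail h ⋆ g)) i
        ≈⟨ +-congʳ (trans (distribˡ _ _ _) (+-cong (C-* i) (sym (⋆-· (h 0) X (ev (tail g)) i)))) ⟩
      C (h 0 * g 0) i + (X ⋆ (h 0 · ev (tail g))) i + (X ⋆ ev (tail h ⋆ g)) i
        ≈⟨ +-assoc _ _ _ ⟩
      C (h 0 * g 0) i + ((X ⋆ (h 0 · ev (tail g))) i + (X ⋆ ev (tail h ⋆ g)) i)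
        ≈⟨ +-congˡ (⋆-distribˡ X (h 0 · ev (tail g)) (ev (tail h ⋆ g)) i) ⟨
      C (h 0 * g 0) i + (X ⋆ (h 0 · ev (tail g) ⊞ ev (tail h ⋆ g))) i
        ≈⟨ +-congˡ (⋆-cong {f = X} (λ _ → refl) (λ j → trans
             (ev-cong (⋆-suc h g) j)
             (trans (ev-+ _ _ j) (+-congʳ (ev-· (h 0) (tail g) j)))) i) ⟨
      C (h 0 * g 0) i + (X ⋆ ev (tail (h ⋆ g))) i
        ≈⟨ ev-unfold (h ⋆ g) i ⟨
      ev (h ⋆ g) i ∎
      where
      C-* : ∀ i → h 0 * C (g 0) i ≈ C (h 0 * g 0) i
      C-* zero = refl
      C-* (suc i) = zeroʳ _

    ev-⋆ : ∀ h g → ev h ⋆ ev g ≋ ev (h ⋆ g)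
    ev-⋆ h g n = ev-⋆-below (suc n) h g n ℕₚ.≤-refl

  -- Coefficient n + 1 of f² is twice `f (suc n)` plus `middle f n`, which involves only f₁, ...,
  -- f_n. As 2 is invertible, the square determines the coefficients one after another.
  square-root-unique : ∀ ½# → ½# * (1# + 1#) ≈ 1# →
                       ∀ f g → f 0 ≈ 1# → g 0 ≈ 1# → f ⋆ f ≋ g ⋆ g → f ≋ g
  square-root-unique ½# half f g f₀ g₀ sq n = below n n ℕₚ.≤-refl
    where
    middle : PS → ℕ → Carrier
    middle f zero = 0#
    middle f (suc n) = (tail f ⋆ tail f) n

    square-suc : ∀ f → f 0 ≈ 1# → ∀ n → (f ⋆ f) (suc n) ≈ (1# + 1#) * f (suc n) + middle f n
    square-suc f f₀ n = begin
      (f ⋆ f) (suc n)                  ≈⟨ ⋆-suc f f n ⟩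
      f 0 * f (suc n) + (tail f ⋆ f) n ≈⟨ +-cong (*-congʳ f₀) (outer n) ⟩
      1# * f (suc n) + (1# * f (suc n) + middle f n) ≈⟨ +-assoc _ _ _ ⟨
      1# * f (suc n) + 1# * f (suc n) + middle f n   ≈⟨ +-congʳ (distribʳ _ _ _) ⟨
      (1# + 1#) * f (suc n) + middle f n ∎
      where
      swap : ∀ n → f (suc n) * f 0 ≈ 1# * f (suc n)
      swap n = trans (*-congˡ f₀) (*-comm _ _)
      outer : ∀ n → (tail f ⋆ f) n ≈ 1# * f (suc n) + middle f n
      outer zero = trans (swap 0) (sym (+-identityʳ _))
      outer (suc n) = trans (⋆-sucʳ (tail f) f n) (+-congʳ (swap (suc n)))

    halve : ∀ a → ½# * ((1# + 1#) * a) ≈ a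
    halve a = trans (sym (*-assoc _ _ _)) (trans (*-congʳ half) (*-identityˡ a))

    double-cancel : ∀ {a b} → (1# + 1#) * a ≈ (1# + 1#) * b → a ≈ b
    double-cancel eq = trans (sym (halve _)) (trans (*-congˡ eq) (halve _))

    below : ∀ n i → i ℕ.≤ n → f i ≈ g i
    below n zero _ = trans f₀ (sym g₀)
    below (suc n) (suc i) (s≤s i≤n) = double-cancel (cancelʳ (begin
      (1# + 1#) * f (suc i) + middle f i ≈⟨ square-suc f f₀ i ⟨
      (f ⋆ f) (suc i)                    ≈⟨ sq (suc i) ⟩
      (g ⋆ g) (suc i)                    ≈⟨ square-suc g g₀ i ⟩
      (1# + 1#) * g (suc i) + middle g i ≈⟨ +-congˡ (middle-cong i i≤n) ⟨
      (1# + 1#) * g (suc i) + middle f i ∎))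
      where
      open import Algebra.Properties.Group +-group using () renaming (∙-cancelʳ to +-cancelʳ)
      cancelʳ : ∀ {x y z} → x + z ≈ y + z → x ≈ y
      cancelʳ {x} {y} {z} = +-cancelʳ z x y
      middle-cong : ∀ i → i ℕ.≤ n → middle f i ≈ middle g i
      middle-cong zero _ = refl
      middle-cong (suc i) i<n = ⋆-local i (λ j j≤i → below n (suc j) (ℕₚ.≤-trans (s≤s j≤i) i<n))
                                          (λ j j≤i → below n (suc j) (ℕₚ.≤-trans (s≤s j≤i) i<n))

-- Insertion sequences with levels

module Levels {c ℓ} (R : CommutativeRing c ℓ) where
  open CommutativeRing R hiding (zero)
  open FiniteSums R
  open PowerSeries R
  open import Relation.Binary.Reasoning.Setoid setoid
  open import Algebra.Properties.CommutativeSemigroup +-commutativeSemigroup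
    using () renaming (x∙yz≈y∙xz to +-left-comm)

  -- levelled (suc m) k p n counts the ways to insert n new minima into a list of length k with minimum in position
  -- p, together with weakly increasing levels 0, …, m of these insertions that rise at every costly one; moving up
  -- a level makes all k + 1 positions available, whence the second summand.  As power series in u,
  --   u^(k+1) · levelled (suc m) k p = φ_m^(k+1) · Cat(φ_m)^(p+1)   with Cat = 1 + u · Cat²,
  -- which explains the product formula levelled-⋆.
  levelled : ℕ → ℕ → ℕ → PS
  levelled zero k p = C 1#
  levelled (suc m) k p zero = 1#
  levelled (suc m) k p (suc n) = Σ≤ p (λ i → levelled (suc m) (suc k) (suc i) n) + levelled m k k (suc n)

  levelled-0 : ∀ m k p → levelled m k p 0 ≈ 1#
  levelled-0 zero k p = refl
  levelled-0 (suc m) k p = refl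

  -- Position p + 1 offers one more free place than p, namely i = p + 1. In the product form this is
  -- Cat = 1 + u · Cat² at u = φ_m, multiplied by φ_m^(k+1) · Cat(φ_m)^(p+1).
  levelled-suc-suc : ∀ m k p n → levelled (suc m) k (suc p) (suc n) ≈
              levelled (suc m) (suc k) (suc (suc p)) n + levelled (suc m) k p (suc n)
  levelled-suc-suc m k p n = trans (+-congʳ (+-comm _ _)) (+-assoc _ _ _)

  -- The hypotheses say g = b + u · a, so this is distributivity, phrased in the shape that the
  -- recursions for `levelled` provide.
  ⋆-splitʳ : ∀ f {g a b} → g 0 ≈ b 0 → tail g ≋ a ⊞ tail b →
             ∀ n → (f ⋆ g) (suc n) ≈ (f ⋆ a) n + (f ⋆ b) (suc n)
  ⋆-splitʳ f {g} {a} {b} g₀ g₊ n = begin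
    (f ⋆ g) (suc n)                                   ≈⟨ ⋆-sucʳ f g n ⟩
    f (suc n) * g 0 + (f ⋆ tail g) n                  ≈⟨ +-cong (*-congˡ g₀) (⋆-cong {f = f} (λ _ → refl) g₊ n) ⟩
    f (suc n) * b 0 + (f ⋆ (a ⊞ tail b)) n            ≈⟨ +-congˡ (⋆-distribˡ f a (tail b) n) ⟩
    f (suc n) * b 0 + ((f ⋆ a) n + (f ⋆ tail b) n)    ≈⟨ +-left-comm _ _ _ ⟩
    (f ⋆ a) n + (f (suc n) * b 0 + (f ⋆ tail b) n)    ≈⟨ +-congˡ (⋆-sucʳ f b n) ⟨
    (f ⋆ a) n + (f ⋆ b) (suc n)                       ∎

  ⋆-splitˡ : ∀ f {g a b} → g 0 ≈ b 0 → tail g ≋ a ⊞ tail b →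
             ∀ n → (g ⋆ f) (suc n) ≈ (a ⋆ f) n + (b ⋆ f) (suc n)
  ⋆-splitˡ f {g} {a} {b} g₀ g₊ n =
    trans (⋆-comm g f (suc n)) (trans (⋆-splitʳ f {g} {a} {b} g₀ g₊ n) (+-cong (⋆-comm f a n) (⋆-comm f b (suc n))))

  -- The two product formulas call each other, descending lexicographically in level, order and
  -- position. The boundary case p = 0 of this one lowers the left factor by a level and leads to
  -- the mixed formula; there p′ = 0 lowers the right factor as well and leads back here.
  levelled-⋆ : ∀ m n k p k′ p′ → (levelled m k p ⋆ levelled m k′ p′) n ≈ levelled m (suc (k ℕ.+ k′)) (suc (p ℕ.+ p′)) n
  -- `levelled m k k` stands for the pure power φ_m^(k+1). In the product form of `levelled (suc m)`
  -- such a factor raises only the exponent of φ_m, so p′ stays.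
  levelled-⋆-mixed : ∀ m n k k′ p′ → (levelled m k k ⋆ levelled (suc m) k′ p′) n ≈ levelled (suc m) (suc (k ℕ.+ k′)) p′ n

  levelled-⋆ zero n k p k′ p′ = trans (C-⋆ 1# (C 1#) n) (*-identityˡ _)
  levelled-⋆ (suc m) zero k p k′ p′ = *-identityˡ _
  levelled-⋆ (suc m) (suc n) k zero k′ p′ = begin
    (levelled (suc m) k 0 ⋆ levelled (suc m) k′ p′) (suc n)
      ≈⟨ ⋆-splitˡ (levelled (suc m) k′ p′) {b = levelled m k k} (sym (levelled-0 m k k)) (λ _ → refl) n ⟩
    (levelled (suc m) (suc k) 1 ⋆ levelled (suc m) k′ p′) n + (levelled m k k ⋆ levelled (suc m) k′ p′) (suc n)
      ≈⟨ +-cong (levelled-⋆ (suc m) n (suc k) 1 k′ p′) (levelled-⋆-mixed m (suc n) k k′ p′) ⟩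
    levelled (suc m) (suc (suc (k ℕ.+ k′))) (suc (suc p′)) n + levelled (suc m) (suc (k ℕ.+ k′)) p′ (suc n)
      ≈⟨ levelled-suc-suc m _ p′ n ⟨
    levelled (suc m) (suc (k ℕ.+ k′)) (suc p′) (suc n) ∎
  levelled-⋆ (suc m) (suc n) k (suc p) k′ p′ = begin
    (levelled (suc m) k (suc p) ⋆ levelled (suc m) k′ p′) (suc n)
      ≈⟨ ⋆-splitˡ (levelled (suc m) k′ p′) {b = levelled (suc m) k p} refl (levelled-suc-suc m k p) n ⟩
    (levelled (suc m) (suc k) (suc (suc p)) ⋆ levelled (suc m) k′ p′) n +
    (levelled (suc m) k p ⋆ levelled (suc m) k′ p′) (suc n)
      ≈⟨ +-cong (levelled-⋆ (suc m) n (suc k) (suc (suc p)) k′ p′) (levelled-⋆ (suc m) (suc n) k p k′ p′) ⟩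
    levelled (suc m) (suc (suc (k ℕ.+ k′))) (suc (suc (suc (p ℕ.+ p′)))) n +
    levelled (suc m) (suc (k ℕ.+ k′)) (suc (p ℕ.+ p′)) (suc n)
      ≈⟨ levelled-suc-suc m _ _ n ⟨
    levelled (suc m) (suc (k ℕ.+ k′)) (suc (suc (p ℕ.+ p′))) (suc n) ∎

  levelled-⋆-mixed m zero k k′ p′ = trans (*-congʳ (levelled-0 m k k)) (*-identityˡ _)
  levelled-⋆-mixed m (suc n) k k′ zero = begin
    (levelled m k k ⋆ levelled (suc m) k′ 0) (suc n)
      ≈⟨ ⋆-splitʳ (levelled m k k) {levelled (suc m) k′ 0} {levelled (suc m) (suc k′) 1} {levelled m k′ k′}
           (sym (levelled-0 m k′ k′)) (λ _ → refl) n ⟩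
    (levelled m k k ⋆ levelled (suc m) (suc k′) 1) n + (levelled m k k ⋆ levelled m k′ k′) (suc n)
      ≈⟨ +-cong (levelled-⋆-mixed m n k (suc k′) 1) (levelled-⋆ m (suc n) k k k′ k′) ⟩
    levelled (suc m) (suc (k ℕ.+ suc k′)) 1 n + levelled m (suc (k ℕ.+ k′)) (suc (k ℕ.+ k′)) (suc n)
      ≡⟨ ≡.cong (λ j → levelled (suc m) (suc j) 1 n + levelled m (suc (k ℕ.+ k′)) (suc (k ℕ.+ k′)) (suc n)) (ℕₚ.+-suc k k′) ⟩
    levelled (suc m) (suc (k ℕ.+ k′)) 0 (suc n) ∎
  levelled-⋆-mixed m (suc n) k k′ (suc p′) = begin
    (levelled m k k ⋆ levelled (suc m) k′ (suc p′)) (suc n)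
      ≈⟨ ⋆-splitʳ (levelled m k k) {levelled (suc m) k′ (suc p′)} {levelled (suc m) (suc k′) (suc (suc p′))}
           {levelled (suc m) k′ p′} refl (levelled-suc-suc m k′ p′) n ⟩
    (levelled m k k ⋆ levelled (suc m) (suc k′) (suc (suc p′))) n + (levelled m k k ⋆ levelled (suc m) k′ p′) (suc n)
      ≈⟨ +-cong (levelled-⋆-mixed m n k (suc k′) (suc (suc p′))) (levelled-⋆-mixed m (suc n) k k′ p′) ⟩
    levelled (suc m) (suc (k ℕ.+ suc k′)) (suc (suc p′)) n + levelled (suc m) (suc (k ℕ.+ k′)) p′ (suc n)
      ≡⟨ ≡.cong (λ j → levelled (suc m) (suc j) (suc (suc p′)) n + levelled (suc m) (suc (k ℕ.+ k′)) p′ (suc n)) (ℕₚ.+-suc k k′) ⟩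
    levelled (suc m) (suc (suc (k ℕ.+ k′))) (suc (suc p′)) n + levelled (suc m) (suc (k ℕ.+ k′)) p′ (suc n)
      ≈⟨ levelled-suc-suc m _ p′ n ⟨
    levelled (suc m) (suc (k ℕ.+ k′)) (suc p′) (suc n) ∎

  φ : ℕ → PS
  φ m zero = 0#
  φ m (suc n) = levelled m 0 0 n

  φ-⋆ : ∀ m n → (φ m ⋆ φ m) (suc (suc n)) ≈ levelled m 1 1 n
  φ-⋆ m n = begin
    (φ m ⋆ φ m) (suc (suc n))                          ≈⟨ ⋆-suc (φ m) (φ m) (suc n) ⟩
    0# * φ m (suc (suc n)) + (tail (φ m) ⋆ φ m) (suc n) ≈⟨ trans (+-congʳ (zeroˡ _)) (+-identityˡ _) ⟩
    (tail (φ m) ⋆ φ m) (suc n)                         ≈⟨ ⋆-sucʳ (tail (φ m)) (φ m) n ⟩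
    levelled m 0 0 (suc n) * 0# + (levelled m 0 0 ⋆ levelled m 0 0) n       ≈⟨ trans (+-congʳ (zeroʳ _)) (+-identityˡ _) ⟩
    (levelled m 0 0 ⋆ levelled m 0 0) n                              ≈⟨ levelled-⋆ m n 0 0 0 0 ⟩
    levelled m 1 1 n                                          ∎

  -- The empty list offers a single place. Using it leaves `levelled (suc m) 1 1`, the coefficient
  -- of the square; moving up a level instead leaves φ_m.
  φ-suc : ∀ m → φ (suc m) ≋ φ m ⊞ φ (suc m) ⋆ φ (suc m)
  φ-suc m zero = sym (trans (+-identityˡ _) (zeroˡ _))
  φ-suc m (suc zero) = sym (trans (+-cong (levelled-0 m 0 0) (trans (+-cong (zeroˡ _) (zeroʳ _)) (+-identityˡ _))) (+-identityʳ _))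
  φ-suc m (suc (suc n)) = trans (+-comm _ _) (+-congˡ (sym (φ-⋆ (suc m) n)))

-- From levels to costs: clearing the powers of 1 - w

module LevelGeneratingFunction {c ℓ} (R : CommutativeRing c ℓ) where
  open CommutativeRing R hiding (zero)
  open PowerSeries R
  open Levels R
  private
    module S = CommutativeRing PS-commutativeRing
    module ΣR = FiniteSums R
    module ΣS = FiniteSums PS-commutativeRing
  open import Relation.Binary.Reasoning.Setoid S.setoid
  open import Algebra.Properties.CommutativeSemigroup S.*-commutativeSemigroup
    using () renaming (x∙yz≈y∙xz to ⋆-left-comm)
  open import Algebra.Properties.Group S.+-group using () renaming (∙-cancelʳ to ⊞-cancelʳ)
  open import Algebra.Properties.CommutativeSemigroup S.+-commutativeSemigroup
    using () renaming (xy∙z≈xz∙y to ⊞-right-comm)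

  w : PS
  w zero = 0#
  w (suc n) = C 1# n

  w-⋆-suc : ∀ f n → (w ⋆ f) (suc n) ≈ f n
  w-⋆-suc f n = trans (⋆-suc w f n) (trans (+-cong (zeroˡ _) (trans (C-⋆ 1# f n) (*-identityˡ _))) (+-identityˡ _))

  δ : PS
  δ = S._-_ S.1# w

  δ-⋆ : ∀ {f g} → f ≋ g ⊞ w ⋆ f → δ ⋆ f ≋ g
  δ-⋆ {f} {g} eq = begin
    δ ⋆ f                               ≈⟨ ⋆-distribʳ f S.1# (S.-_ w) ⟩
    S.1# ⋆ f ⊞ (S.-_ w) ⋆ f             ≈⟨ S.+-cong (S.*-identityˡ f) (S.sym (-‿distribˡ-* w f)) ⟩
    f ⊞ S.-_ (w ⋆ f)                    ≈⟨ S.+-congʳ eq ⟩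
    g ⊞ w ⋆ f ⊞ S.-_ (w ⋆ f)            ≈⟨ S.+-assoc g _ _ ⟩
    g ⊞ (w ⋆ f ⊞ S.-_ (w ⋆ f))          ≈⟨ S.+-congˡ (S.-‿inverseʳ (w ⋆ f)) ⟩
    g ⊞ S.0#                            ≈⟨ S.+-identityʳ g ⟩
    g                                   ∎
    where open import Algebra.Properties.Ring S.ring using (-‿distribˡ-*)

  infixr 8 _^_
  _^_ : PS → ℕ → PS
  f ^ zero = S.1#
  f ^ suc n = f ⋆ f ^ n

  -- insertionGF n k p c counts, by final cost, the ways to insert n further new minima into a list of length k
  -- whose minimum is its p-th entry (p = 0 for the empty list), starting from cost c.
  insertionGF : ℕ → ℕ → ℕ → ℕ → PS
  insertionGF zero k p c = w ^ c
  insertionGF (suc n) k p c = ΣS.Σ≤ k λ i → insertionGF n (suc k) (suc i) (if i ℕ.≤ᵇ p then c else suc c)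

  insertionGF-suc : ∀ n k p c → insertionGF n k p (suc c) ≋ w ⋆ insertionGF n k p c
  insertionGF-suc zero k p c = S.refl
  insertionGF-suc (suc n) k p c = S.trans
    (ΣS.Σ≤-cong k λ i _ → step i (i ℕ.≤ᵇ p))
    (S.sym (ΣS.Σ≤-*ˡ k w _))
    where
    step : ∀ i b → insertionGF n (suc k) (suc i) (if b then suc c else suc (suc c)) ≋
                   w ⋆ insertionGF n (suc k) (suc i) (if b then c else suc c)
    step i true = insertionGF-suc n (suc k) (suc i) c
    step i false = insertionGF-suc n (suc k) (suc i) (suc c)

  -- Places up to p have weight 1 and those behind have weight w, giving Σ_p + w (Σ_k - Σ_p); the
  -- negative term is moved to the left-hand side.
  insertionGF-recursion : ∀ n k p c → p ℕ.≤ k →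
    insertionGF (suc n) k p c ⊞ w ⋆ ΣS.Σ≤ p (λ i → insertionGF n (suc k) (suc i) c) ≋
    ΣS.Σ≤ p (λ i → insertionGF n (suc k) (suc i) c) ⊞ w ⋆ ΣS.Σ≤ k (λ i → insertionGF n (suc k) (suc i) c)
  insertionGF-recursion n k p c p≤k = go k p≤k
    where
    f : ℕ → PS
    f i = insertionGF n (suc k) (suc i) c
    g : ℕ → PS
    g i = insertionGF n (suc k) (suc i) (if i ℕ.≤ᵇ p then c else suc c)
    g-low : ∀ i → i ℕ.≤ p → g i ≋ f i
    g-low i i≤p rewrite ≤ᵇ-true i≤p = S.refl
    g-high : ∀ i → p ℕ.< i → g i ≋ w ⋆ f i
    g-high i p<i rewrite ≤ᵇ-false p<i = insertionGF-suc n (suc k) (suc i) c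
    go : ∀ j → p ℕ.≤ j → ΣS.Σ≤ j g ⊞ w ⋆ ΣS.Σ≤ p f ≋ ΣS.Σ≤ p f ⊞ w ⋆ ΣS.Σ≤ j f
    go j p≤j with ℕₚ.m≤n⇒m<n∨m≡n p≤j
    go j p≤j | inj₂ ≡.refl = S.+-congʳ (ΣS.Σ≤-cong j g-low)
    go (suc j) _ | inj₁ (s≤s p≤j) = begin
      ΣS.Σ≤ j g ⊞ g (suc j) ⊞ w ⋆ ΣS.Σ≤ p f        ≈⟨ ⊞-right-comm (ΣS.Σ≤ j g) _ _ ⟩
      ΣS.Σ≤ j g ⊞ w ⋆ ΣS.Σ≤ p f ⊞ g (suc j)        ≈⟨ S.+-cong (go j p≤j) (g-high (suc j) (s≤s p≤j)) ⟩
      ΣS.Σ≤ p f ⊞ w ⋆ ΣS.Σ≤ j f ⊞ w ⋆ f (suc j)    ≈⟨ S.+-assoc (ΣS.Σ≤ p f) _ _ ⟩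
      ΣS.Σ≤ p f ⊞ (w ⋆ ΣS.Σ≤ j f ⊞ w ⋆ f (suc j))  ≈⟨ S.+-congˡ (⋆-distribˡ w (ΣS.Σ≤ j f) (f (suc j))) ⟨
      ΣS.Σ≤ p f ⊞ w ⋆ (ΣS.Σ≤ j f ⊞ f (suc j))      ∎

  -- The coefficient of w^j admits the levels 0, ..., j, that is j + 1 of them; hence `suc j`.
  levelledGF : ℕ → ℕ → ℕ → PS
  levelledGF n k p j = levelled (suc j) k p n

  Σ≤-apply : ∀ m (F : ℕ → PS) j → ΣS.Σ≤ m F j ≡ ΣR.Σ≤ m (λ i → F i j)
  Σ≤-apply zero F j = ≡.refl
  Σ≤-apply (suc m) F j = ≡.cong (_+ F (suc m) j) (Σ≤-apply m F j)

  levelledGF-zero : ∀ k p → levelledGF 0 k p ≋ S.1# ⊞ w ⋆ levelledGF 0 k p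
  levelledGF-zero k p zero = sym (trans (+-congˡ (zeroˡ _)) (+-identityʳ _))
  levelledGF-zero k p (suc j) = sym (trans (+-identityˡ _) (w-⋆-suc (levelledGF 0 k p) j))

  levelledGF-suc : ∀ n k p → levelledGF (suc n) k p ≋
                   ΣS.Σ≤ p (λ i → levelledGF n (suc k) (suc i)) ⊞ w ⋆ levelledGF (suc n) k k
  -- At w^0 there is no lower level to come from: `levelled 0 k k (suc n)` is 0, which agrees with
  -- the constant term of a multiple of w.
  levelledGF-suc n k p zero rewrite Σ≤-apply p (λ i → levelledGF n (suc k) (suc i)) 0 = +-congˡ (sym (zeroˡ _))
  levelledGF-suc n k p (suc j) rewrite Σ≤-apply p (λ i → levelledGF n (suc k) (suc i)) (suc j) =
    +-congˡ (sym (w-⋆-suc (levelledGF (suc n) k k) j))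

  -- For p = k the recursion `levelledGF-suc` refers to itself and says (1-w) ·
  -- `levelledGF (suc n) k k` = `ΣY k`. Inserting this into the recursion for general p yields (1-w)
  -- · `ΣW p` + w · `ΣW k`, the right-hand side of `insertionGF-recursion` in disguise.
  δ^-levelledGF : ∀ n k p → p ℕ.≤ k → δ ^ suc n ⋆ levelledGF n k p ≋ insertionGF n k p 0
  δ^-levelledGF zero k p _ = S.trans (S.*-congʳ {levelledGF 0 k p} {δ ⋆ S.1#} {δ} (S.*-identityʳ δ))
    (δ-⋆ (levelledGF-zero k p))
  δ^-levelledGF (suc n) k p p≤k = ⊞-cancelʳ (w ⋆ ΣW p) _ _ (begin
    δ ⋆ δ ^ suc n ⋆ levelledGF (suc n) k p ⊞ w ⋆ ΣW p
      ≈⟨ S.+-congʳ (S.trans (S.*-congˡ {δ ⋆ δ ^ suc n} {levelledGF (suc n) k p} (levelledGF-suc n k p))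
           (⋆-distribˡ (δ ⋆ δ ^ suc n) (ΣY p) (w ⋆ levelledGF (suc n) k k))) ⟩
    δ ⋆ δ ^ suc n ⋆ ΣY p ⊞ δ ⋆ δ ^ suc n ⋆ (w ⋆ levelledGF (suc n) k k) ⊞ w ⋆ ΣW p
      ≈⟨ S.+-congʳ (S.+-cong (first p p≤k) second) ⟩
    δ ⋆ ΣW p ⊞ w ⋆ ΣW k ⊞ w ⋆ ΣW p
      ≈⟨ ⊞-right-comm (δ ⋆ ΣW p) _ _ ⟩
    δ ⋆ ΣW p ⊞ w ⋆ ΣW p ⊞ w ⋆ ΣW k
      ≈⟨ S.+-congʳ δ+w ⟩
    ΣW p ⊞ w ⋆ ΣW k
      ≈⟨ insertionGF-recursion n k p 0 p≤k ⟨
    insertionGF (suc n) k p 0 ⊞ w ⋆ ΣW p ∎)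
    where
    ΣY ΣW : ℕ → PS
    ΣY p = ΣS.Σ≤ p λ i → levelledGF n (suc k) (suc i)
    ΣW p = ΣS.Σ≤ p λ i → insertionGF n (suc k) (suc i) 0
    δ^-ΣY : ∀ p → p ℕ.≤ k → δ ^ suc n ⋆ ΣY p ≋ ΣW p
    δ^-ΣY p p≤k = S.trans (ΣS.Σ≤-*ˡ p (δ ^ suc n) _)
      (ΣS.Σ≤-cong p λ i i≤p → δ^-levelledGF n (suc k) (suc i) (s≤s (ℕₚ.≤-trans i≤p p≤k)))
    first : ∀ p → p ℕ.≤ k → δ ⋆ δ ^ suc n ⋆ ΣY p ≋ δ ⋆ ΣW p
    first p p≤k = S.trans (⋆-assoc δ (δ ^ suc n) (ΣY p)) (S.*-congˡ {δ} (δ^-ΣY p p≤k))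
    YY = levelledGF (suc n) k k
    second : δ ⋆ δ ^ suc n ⋆ (w ⋆ levelledGF (suc n) k k) ≋ w ⋆ ΣW k
    second = begin
      δ ⋆ δ ^ suc n ⋆ (w ⋆ levelledGF (suc n) k k)   ≈⟨ ⋆-left-comm (δ ⋆ δ ^ suc n) w YY ⟩
      w ⋆ (δ ⋆ δ ^ suc n ⋆ levelledGF (suc n) k k)   ≈⟨ S.*-congˡ {w} (S.*-congʳ {YY} (⋆-comm δ (δ ^ suc n))) ⟩
      w ⋆ (δ ^ suc n ⋆ δ ⋆ levelledGF (suc n) k k)   ≈⟨ S.*-congˡ {w} (⋆-assoc (δ ^ suc n) δ YY) ⟩
      w ⋆ (δ ^ suc n ⋆ (δ ⋆ levelledGF (suc n) k k)) ≈⟨ S.*-congˡ {w} (S.*-congˡ {δ ^ suc n} (δ-⋆ (levelledGF-suc n k k))) ⟩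
      w ⋆ (δ ^ suc n ⋆ ΣY k)                ≈⟨ S.*-congˡ {w} (δ^-ΣY k ℕₚ.≤-refl) ⟩
      w ⋆ ΣW k                              ∎
    δ+w : δ ⋆ ΣW p ⊞ w ⋆ ΣW p ≋ ΣW p
    δ+w = begin
      δ ⋆ ΣW p ⊞ w ⋆ ΣW p            ≈⟨ ⋆-distribʳ (ΣW p) δ w ⟨
      (δ ⊞ w) ⋆ ΣW p                 ≈⟨ S.*-congʳ {ΣW p} (S.trans (S.+-assoc S.1# (S.-_ w) w)
                                          (S.trans (S.+-congˡ (S.-‿inverseˡ w)) (S.+-identityʳ S.1#))) ⟩
      S.1# ⋆ ΣW p                    ≈⟨ S.*-identityˡ (ΣW p) ⟩
      ΣW p                           ∎

module SquareLemma {c ℓ} (R : CommutativeRing c ℓ) where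
  open CommutativeRing R renaming (refl to ≈-refl; trans to ≈-trans)
  open import Relation.Binary.Reasoning.Setoid setoid
  open import Algebra.Solver.Ring.NaturalCoefficients.Default commutativeSemiring
  open import Algebra.Properties.Group +-group using () renaming (∙-cancelʳ to +-cancelʳ)

  -- With a = 1 - 2p and b = 1 - 2q this is a² = 2b - 1, stated without subtraction.
  square-of-1-2p : ∀ a b p q → a + (p + p) ≈ 1# → b + (q + q) ≈ 1# → p ≈ q + p * p → a * a + 1# ≈ b + b
  square-of-1-2p a b p q a≈ b≈ p≈ = +-cancelʳ ((q + q + q + q) + 4p²) _ _ (begin
    a * a + 1# + ((q + q + q + q) + 4p²)
      ≈⟨ solve 4 (λ a p q o → a :* a :+ o :+ ((q :+ q :+ q :+ q) :+ (p :* p :+ p :* p :+ p :* p :+ p :* p))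
            := a :* a :+ o :+ ((q :+ p :* p) :+ (q :+ p :* p) :+ (q :+ p :* p) :+ (q :+ p :* p))) ≈-refl a p q 1# ⟩
    a * a + 1# + ((q + p * p) + (q + p * p) + (q + p * p) + (q + p * p))
      ≈⟨ +-congˡ (+-cong (+-cong (+-cong p≈ p≈) p≈) p≈) ⟨
    a * a + 1# + (p + p + p + p)
      ≈⟨ +-congˡ (≈-trans (*-congˡ a≈) (*-identityʳ _)) ⟨
    a * a + 1# + (p + p + p + p) * (a + (p + p))
      ≈⟨ solve 3 (λ a p o → a :* a :+ o :+ (p :+ p :+ p :+ p) :* (a :+ (p :+ p))
            := (a :+ (p :+ p)) :* (a :+ (p :+ p)) :+ o :+ (p :* p :+ p :* p :+ p :* p :+ p :* p)) ≈-refl a p 1# ⟩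
    (a + (p + p)) * (a + (p + p)) + 1# + 4p²
      ≈⟨ +-congʳ (+-congʳ (≈-trans (*-cong a≈ a≈) (*-identityˡ _))) ⟩
    1# + 1# + 4p²
      ≈⟨ +-congʳ (+-cong b≈ b≈) ⟨
    (b + (q + q)) + (b + (q + q)) + 4p²
      ≈⟨ solve 3 (λ b q r → (b :+ (q :+ q)) :+ (b :+ (q :+ q)) :+ r := b :+ b :+ ((q :+ q :+ q :+ q) :+ r)) ≈-refl b q 4p² ⟩
    b + b + ((q + q + q + q) + 4p²) ∎)
    where
    4p² : Carrier
    4p² = p * p + p * p + p * p + p * p

import Data.Integer as ℤ
import Data.Integer.Properties as ℤₚ
open import Data.Rational as ℚ using (ℚ; 0ℚ; 1ℚ; ½; _+_; _*_; _-_; -_; _/_; toℚᵘ)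
import Data.Rational.Properties as ℚₚ
open import Data.Rational.Solver using (module +-*-Solver)
open import Data.Rational.Unnormalised as ℚᵘ using (mkℚᵘ)
import Data.Rational.Unnormalised.Properties as ℚᵘₚ
open ≡ using (refl; sym; trans; cong; cong₂; subst; _≢_; module ≡-Reasoning)

-- Square roots of series and the closed form of ψ

toℚᵘ-fromℕℚ : ∀ n → toℚᵘ (fromℕℚ n) ℚᵘ.≃ mkℚᵘ (ℤ.+ n) 0
toℚᵘ-fromℕℚ n = ℚₚ.toℚᵘ-fromℚᵘ (mkℚᵘ (ℤ.+ n) 0)

fromℕℚ-+ : ∀ m n → fromℕℚ (m ℕ.+ n) ≡ fromℕℚ m + fromℕℚ n
fromℕℚ-+ m n = ℚₚ.toℚᵘ-injective (begin
  toℚᵘ (fromℕℚ (m ℕ.+ n)) ≈⟨ toℚᵘ-fromℕℚ (m ℕ.+ n) ⟩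
  mkℚᵘ (ℤ.+ (m ℕ.+ n)) 0 ≈⟨ ℚᵘ.*≡* (cong (ℤ._* ℤ.+ 1) (cong₂ ℤ._+_ (sym (ℤₚ.*-identityʳ (ℤ.+ m))) (sym (ℤₚ.*-identityʳ (ℤ.+ n))))) ⟩
  mkℚᵘ (ℤ.+ m) 0 ℚᵘ.+ mkℚᵘ (ℤ.+ n) 0 ≈⟨ ℚᵘₚ.+-cong (toℚᵘ-fromℕℚ m) (toℚᵘ-fromℕℚ n) ⟨
  toℚᵘ (fromℕℚ m) ℚᵘ.+ toℚᵘ (fromℕℚ n) ≈⟨ ℚₚ.toℚᵘ-homo-+ (fromℕℚ m) (fromℕℚ n) ⟨
  toℚᵘ (fromℕℚ m + fromℕℚ n) ∎)
  where open import Relation.Binary.Reasoning.Setoid ℚᵘₚ.≃-setoid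

1/-inverse : ∀ k → fromℕℚ (suc k) * (ℤ.+ 1 / suc k) ≡ 1ℚ
1/-inverse k = ℚₚ.toℚᵘ-injective (begin
  toℚᵘ (fromℕℚ (suc k) * (ℤ.+ 1 / suc k)) ≈⟨ ℚₚ.toℚᵘ-homo-* (fromℕℚ (suc k)) (ℤ.+ 1 / suc k) ⟩
  toℚᵘ (fromℕℚ (suc k)) ℚᵘ.* toℚᵘ (ℤ.+ 1 / suc k)
    ≈⟨ ℚᵘₚ.*-cong (toℚᵘ-fromℕℚ (suc k)) (ℚₚ.toℚᵘ-fromℚᵘ (mkℚᵘ (ℤ.+ 1) k)) ⟩
  mkℚᵘ (ℤ.+ suc k) 0 ℚᵘ.* mkℚᵘ (ℤ.+ 1) k
    ≈⟨ ℚᵘ.*≡* (trans (ℤₚ.*-identityʳ _) (trans (ℤₚ.*-comm (ℤ.+ suc k) (ℤ.+ 1))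
         (cong (ℤ.+ 1 ℤ.*_) (cong ℤ.+_ (sym (ℕₚ.*-identityˡ (suc k))))))) ⟩
  toℚᵘ 1ℚ ∎)
  where open import Relation.Binary.Reasoning.Setoid ℚᵘₚ.≃-setoid

suc-cancelˡ : ∀ k {p q} → fromℕℚ (suc k) * p ≡ fromℕℚ (suc k) * q → p ≡ q
suc-cancelˡ k {p} {q} eq = trans (sym (undo p)) (trans (cong ((ℤ.+ 1 / suc k) *_) eq) (undo q))
  where
  undo : ∀ r → (ℤ.+ 1 / suc k) * (fromℕℚ (suc k) * r) ≡ r
  undo r = trans (sym (ℚₚ.*-assoc (ℤ.+ 1 / suc k) (fromℕℚ (suc k)) r))
    (trans (cong (_* r) (trans (ℚₚ.*-comm (ℤ.+ 1 / suc k) (fromℕℚ (suc k))) (1/-inverse k))) (ℚₚ.*-identityˡ r))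

ℚ-ring : CommutativeRing _ _
ℚ-ring = ℚₚ.+-*-commutativeRing

private
  module ℚΣ = FiniteSums ℚ-ring
  module ℚw = PowerSeries ℚ-ring

ℚw-ring : CommutativeRing _ _
ℚw-ring = ℚw.PS-commutativeRing

module HalfChoose where
  open ℚw
  open ≡-Reasoning

  -- The Euler operator x · d/dx: a derivation that keeps the index of each coefficient.
  θ : PS → PS
  θ f n = fromℕℚ n * f n

  θ-⋆ : ∀ f g → θ (f ⋆ g) ≋ (θ f ⋆ g) ⊞ (f ⋆ θ g)
  θ-⋆ f g n = trans (ℚΣ.Σ≤-*ˡ n (fromℕℚ n) (λ i → f i * g (n ∸ i))) (trans (ℚΣ.Σ≤-cong n step) (ℚΣ.Σ≤-+ n _ _))
    where
    step : ∀ i → i ℕ.≤ n → fromℕℚ n * (f i * g (n ∸ i)) ≡ fromℕℚ i * f i * g (n ∸ i) + f i * (fromℕℚ (n ∸ i) * g (n ∸ i))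
    step i i≤n = begin
      fromℕℚ n * (f i * g (n ∸ i))
        ≡⟨ cong (λ k → fromℕℚ k * (f i * g (n ∸ i))) (ℕₚ.m+[n∸m]≡n i≤n) ⟨
      fromℕℚ (i ℕ.+ (n ∸ i)) * (f i * g (n ∸ i))
        ≡⟨ cong (_* (f i * g (n ∸ i))) (fromℕℚ-+ i (n ∸ i)) ⟩
      (fromℕℚ i + fromℕℚ (n ∸ i)) * (f i * g (n ∸ i))
        ≡⟨ solve 4 (λ a b x z → (a :+ b) :* (x :* z) := a :* x :* z :+ x :* (b :* z)) refl
             (fromℕℚ i) (fromℕℚ (n ∸ i)) (f i) (g (n ∸ i)) ⟩
      fromℕℚ i * f i * g (n ∸ i) + f i * (fromℕℚ (n ∸ i) * g (n ∸ i)) ∎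
      where open +-*-Solver

  θ-square : ∀ f n → fromℕℚ n * (f ⋆ f) n ≡ (θ f ⋆ f) n + (θ f ⋆ f) n
  θ-square f n = trans (θ-⋆ f f n) (cong (λ x → (θ f ⋆ f) n + x) (⋆-comm f (θ f) n))

  -- The binomial series h satisfies (1 + x) h′ = ½ h.
  tail-θ : ∀ n → tail (θ halfChoose) n ≡ ½ * halfChoose n + (- 1ℚ) * θ halfChoose n
  tail-θ n = begin
    fromℕℚ (suc n) * (halfChoose n * (½ - fromℕℚ n) * (ℤ.+ 1 / suc n))
      ≡⟨ solve 4 (λ s h k i → s :* (h :* (con ½ :- k) :* i) := s :* i :* (h :* (con ½ :- k))) refl
           (fromℕℚ (suc n)) (halfChoose n) (fromℕℚ n) (ℤ.+ 1 / suc n) ⟩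
    fromℕℚ (suc n) * (ℤ.+ 1 / suc n) * (halfChoose n * (½ - fromℕℚ n))
      ≡⟨ cong (_* (halfChoose n * (½ - fromℕℚ n))) (1/-inverse n) ⟩
    1ℚ * (halfChoose n * (½ - fromℕℚ n))
      ≡⟨ solve 2 (λ h k → con 1ℚ :* (h :* (con ½ :- k)) := con ½ :* h :+ con (- 1ℚ) :* (k :* h)) refl
           (halfChoose n) (fromℕℚ n) ⟩
    ½ * halfChoose n + (- 1ℚ) * (fromℕℚ n * halfChoose n) ∎
    where open +-*-Solver

  square : PS
  square = halfChoose ⋆ halfChoose

  -- Multiplying the differential equation of h by 2h gives (1 + x) s′ = s for s = h²; this is its
  -- coefficient of x^n.
  square-recursion : ∀ n → fromℕℚ (suc n) * square (suc n) ≡ (1ℚ - fromℕℚ n) * square n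
  square-recursion n = begin
    fromℕℚ (suc n) * square (suc n)
      ≡⟨ θ-square h (suc n) ⟩
    (θ h ⋆ h) (suc n) + (θ h ⋆ h) (suc n)
      ≡⟨ cong₂ _+_ derive derive ⟩
    (½ * square n + (- 1ℚ) * (θ h ⋆ h) n) + (½ * square n + (- 1ℚ) * (θ h ⋆ h) n)
      ≡⟨ solve 2 (λ s t → (con ½ :* s :+ con (- 1ℚ) :* t) :+ (con ½ :* s :+ con (- 1ℚ) :* t) := s :- (t :+ t)) refl
           (square n) ((θ h ⋆ h) n) ⟩
    square n - ((θ h ⋆ h) n + (θ h ⋆ h) n)
      ≡⟨ cong (λ x → square n - x) (θ-square h n) ⟨
    square n - fromℕℚ n * square n
      ≡⟨ solve 2 (λ s k → s :- k :* s := (con 1ℚ :- k) :* s) refl (square n) (fromℕℚ n) ⟩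
    (1ℚ - fromℕℚ n) * square n ∎
    where
    open +-*-Solver
    h : PS
    h = halfChoose
    derive : (θ h ⋆ h) (suc n) ≡ ½ * square n + (- 1ℚ) * (θ h ⋆ h) n
    derive = begin
      (θ h ⋆ h) (suc n)
        ≡⟨ ⋆-suc (θ h) h n ⟩
      0ℚ * 1ℚ * h (suc n) + (tail (θ h) ⋆ h) n
        ≡⟨ cong (_+ (tail (θ h) ⋆ h) n) (ℚₚ.*-zeroˡ (h (suc n))) ⟩
      0ℚ + (tail (θ h) ⋆ h) n
        ≡⟨ ℚₚ.+-identityˡ _ ⟩
      (tail (θ h) ⋆ h) n
        ≡⟨ ⋆-cong {g = h} tail-θ (λ _ → refl) n ⟩
      ((½ · h ⊞ (- 1ℚ) · θ h) ⋆ h) n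
        ≡⟨ ⋆-distribʳ h (½ · h) ((- 1ℚ) · θ h) n ⟩
      ((½ · h) ⋆ h) n + (((- 1ℚ) · θ h) ⋆ h) n
        ≡⟨ cong₂ _+_ (·-⋆-assoc ½ h h n) (·-⋆-assoc (- 1ℚ) (θ h) h n) ⟩
      ½ * square n + (- 1ℚ) * (θ h ⋆ h) n ∎

  1+x : PS
  1+x zero = 1ℚ
  1+x (suc n) = C 1ℚ n

  -- The recursion gives the coefficient of x² the factor 1 - 1, and every later coefficient is a
  -- multiple of its predecessor.
  square≋1+x : square ≋ 1+x
  square≋1+x zero = refl
  square≋1+x (suc zero) = refl
  square≋1+x (suc (suc n)) = suc-cancelˡ (suc n) (trans (square-recursion (suc n))
    (trans (zero-factor n (square≋1+x (suc n))) (sym (ℚₚ.*-zeroʳ (fromℕℚ (suc (suc n)))))))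
    where
    zero-factor : ∀ n → square (suc n) ≡ 1+x (suc n) → (1ℚ - fromℕℚ (suc n)) * square (suc n) ≡ 0ℚ
    zero-factor zero _ = refl
    zero-factor (suc n) eq = trans (cong ((1ℚ - fromℕℚ (suc (suc n))) *_) eq) (ℚₚ.*-zeroʳ (1ℚ - fromℕℚ (suc (suc n))))

private
  module GF = LevelGeneratingFunction ℚ-ring
  module L = Levels ℚ-ring
  module SΣ = FiniteSums ℚw-ring
  module S = PowerSeries ℚw-ring
  module ZW = CommutativeRing S.PS-commutativeRing
  module QW = CommutativeRing ℚw-ring
  module Z = LevelGeneratingFunction ℚw-ring

sumTo≡Σ≤ : ∀ n (f : ℕ → ℚ) → sumTo n f ≡ ℚΣ.Σ≤ n f
sumTo≡Σ≤ zero f = refl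
sumTo≡Σ≤ (suc n) f = cong (_+ f (suc n)) (sumTo≡Σ≤ n f)

⊛≋⋆ : ∀ F G → (F ⊛ G) S.≋ (F S.⋆ G)
⊛≋⋆ F G n t = begin
  sumTo n (λ i → sumTo t (λ j → F i j * G (n ∸ i) (t ∸ j)))
    ≡⟨ sumTo≡Σ≤ n _ ⟩
  ℚΣ.Σ≤ n (λ i → sumTo t (λ j → F i j * G (n ∸ i) (t ∸ j)))
    ≡⟨ ℚΣ.Σ≤-cong n (λ i _ → sumTo≡Σ≤ t _) ⟩
  ℚΣ.Σ≤ n (λ i → (F i ℚw.⋆ G (n ∸ i)) t)
    ≡⟨ GF.Σ≤-apply n (λ i → F i ℚw.⋆ G (n ∸ i)) t ⟨
  (F S.⋆ G) n t ∎
  where open ≡-Reasoning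

const≋C : ∀ q → const q S.≋ S.C (ℚw.C q)
const≋C q zero zero = refl
const≋C q zero (suc t) = refl
const≋C q (suc n) t = refl

C-cong : ∀ {a b} → a ℚw.≋ b → S.C a S.≋ S.C b
C-cong a≋b zero = a≋b
C-cong a≋b (suc n) t = refl

module SquareRoot (F : Series) (F₀ : F 0 ℚw.≋ ℚw.C 1ℚ) where
  X : Series
  X = F ⊖ const 1ℚ

  X₀ : ∀ t → X 0 t ≡ 0ℚ
  X₀ t = trans (cong₂ _-_ (F₀ t) (const≋C 1ℚ 0 t)) (ℚₚ.+-inverseʳ (ℚw.C 1ℚ t))

  open S.Substitution X X₀

  h : Series
  h k = ℚw.C (halfChoose k)

  pow≋power : ∀ k → pow X k S.≋ power k
  pow≋power zero = const≋C 1ℚ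
  pow≋power (suc k) = ZW.trans (⊛≋⋆ X (pow X k)) (ZW.*-congˡ {X} (pow≋power k))

  -- By `F₀` the whole z^0 coefficient of X vanishes, not just its constant term, so the powers with
  -- n < k ≤ n + t contribute nothing.
  sqrtS≋ev : sqrtS F S.≋ ev h
  sqrtS≋ev n t = begin
    sumTo (n ℕ.+ t) (λ k → halfChoose k * pow X k n t)
      ≡⟨ sumTo≡Σ≤ (n ℕ.+ t) _ ⟩
    ℚΣ.Σ≤ (n ℕ.+ t) (λ k → halfChoose k * pow X k n t)
      ≡⟨ ℚΣ.Σ≤-cong (n ℕ.+ t) (λ k _ → trans (ℚw.C-⋆ (halfChoose k) (power k n) t) (cong (halfChoose k *_) (sym (pow≋power k n t)))) ⟨
    ℚΣ.Σ≤ (n ℕ.+ t) (λ k → (h k ℚw.⋆ power k n) t)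
      ≡⟨ GF.Σ≤-apply (n ℕ.+ t) (λ k → h k ℚw.⋆ power k n) t ⟨
    SΣ.Σ≤ (n ℕ.+ t) (λ k → h k ℚw.⋆ power k n) t
      ≡⟨ ev-extend h n (n ℕ.+ t) (ℕₚ.m≤m+n n t) t ⟩
    ev h n t ∎
    where open ≡-Reasoning

  h⋆h : (h S.⋆ h) S.≋ λ k → ℚw.C (HalfChoose.1+x k)
  h⋆h k t = begin
    (h S.⋆ h) k t
      ≡⟨ GF.Σ≤-apply k (λ i → h i ℚw.⋆ h (k ∸ i)) t ⟩
    ℚΣ.Σ≤ k (λ i → (h i ℚw.⋆ h (k ∸ i)) t)
      ≡⟨ ℚΣ.Σ≤-cong k (λ i _ → trans (ℚw.C-⋆ (halfChoose i) (h (k ∸ i)) t) (*-C t (halfChoose i) (halfChoose (k ∸ i)))) ⟩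
    ℚΣ.Σ≤ k (λ i → ℚw.C (halfChoose i * halfChoose (k ∸ i)) t)
      ≡⟨ Σ≤-C t ⟩
    ℚw.C (HalfChoose.square k) t
      ≡⟨ cong (λ q → ℚw.C q t) (HalfChoose.square≋1+x k) ⟩
    ℚw.C (HalfChoose.1+x k) t ∎
    where
    open ≡-Reasoning
    *-C : ∀ t a b → a * ℚw.C b t ≡ ℚw.C (a * b) t
    *-C zero a b = refl
    *-C (suc t) a b = ℚₚ.*-zeroʳ a
    Σ≤-C : ∀ t → ℚΣ.Σ≤ k (λ i → ℚw.C (halfChoose i * halfChoose (k ∸ i)) t) ≡ ℚw.C (HalfChoose.square k) t
    Σ≤-C zero = refl
    Σ≤-C (suc t) = ℚΣ.Σ≤-0 k

  ev-C1 : ∀ g → g 0 ℚw.≋ ℚw.C 1ℚ → (∀ k → g (suc k) ℚw.≋ λ _ → 0ℚ) → ev g S.≋ ZW.1#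
  ev-C1 g g₀ g₊ = ZW.trans (ev-unfold g) (ZW.trans (ZW.+-cong (C-cong g₀)
    (ZW.trans (ZW.*-congˡ {X} (λ n → QW.trans
        (SΣ.Σ≤-cong n λ k _ → QW.trans (QW.*-congʳ {power k n} (g₊ k)) (QW.zeroˡ (power k n))) (SΣ.Σ≤-0 n)))
      (ZW.zeroʳ X))) (ZW.+-identityʳ ZW.1#))

  sqrtS-square : (sqrtS F S.⋆ sqrtS F) S.≋ F
  sqrtS-square = begin
    sqrtS F S.⋆ sqrtS F           ≈⟨ ZW.*-cong sqrtS≋ev sqrtS≋ev ⟩
    ev h S.⋆ ev h                 ≈⟨ ev-⋆ h h ⟩
    ev (h S.⋆ h)                  ≈⟨ ev-cong h⋆h ⟩
    ev d                          ≈⟨ ev-unfold d ⟩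
    ZW.1# S.⊞ X S.⋆ ev (S.tail d) ≈⟨ ZW.+-congˡ {ZW.1#} (ZW.*-congˡ {X} (ev-C1 (S.tail d) (λ _ → refl)
                                       (λ { k zero → refl ; k (suc t) → refl }))) ⟩
    ZW.1# S.⊞ X S.⋆ ZW.1#         ≈⟨ ZW.+-congˡ {ZW.1#} (ZW.*-identityʳ X) ⟩
    ZW.1# S.⊞ X                   ≈⟨ (λ n t → trans (cong (_+ X n t) (sym (const≋C 1ℚ n t))) (cancel (const 1ℚ n t) (F n t))) ⟩
    F                             ∎
    where
    open import Relation.Binary.Reasoning.Setoid ZW.setoid
    d : Series
    d k = ℚw.C (HalfChoose.1+x k)
    cancel : ∀ a b → a + (b - a) ≡ b
    cancel = solve 2 (λ a b → a :+ (b :- a) := b) refl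
      where open +-*-Solver

  sqrtS-0 : sqrtS F 0 ℚw.≋ ℚw.C 1ℚ
  sqrtS-0 t = trans (sqrtS≋ev 0 t) (trans (QW.*-identityʳ (h 0) t) refl)

sqrtS-unique : ∀ F G → F S.≋ (G S.⋆ G) → G 0 ℚw.≋ ℚw.C 1ℚ → sqrtS F S.≋ G
sqrtS-unique F G F≋G² G₀ = S.square-root-unique (ℚw.C ½) half (sqrtS F) G sqrtS-0 G₀
  (ZW.trans sqrtS-square F≋G²)
  where
  F₀ : F 0 ℚw.≋ ℚw.C 1ℚ
  F₀ = QW.trans (F≋G² 0) (QW.trans (QW.*-cong G₀ G₀) (QW.*-identityˡ QW.1#))
  open SquareRoot F F₀
  half : (ℚw.C ½ ℚw.⋆ (QW.1# QW.+ QW.1#)) ℚw.≋ QW.1#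
  half zero = refl
  half (suc t) = ℚw.C-⋆ ½ (QW.1# QW.+ QW.1#) (suc t)

-- The substitution u = z(1-w)

Φ : ℕ → Series
Φ m n = L.φ m n ℚw.· GF.δ GF.^ n

^-+ : ∀ f i j → ((f GF.^ i) ℚw.⋆ (f GF.^ j)) ℚw.≋ (f GF.^ (i ℕ.+ j))
^-+ f zero j = QW.*-identityˡ (f GF.^ j)
^-+ f (suc i) j = QW.trans (ℚw.⋆-assoc f (f GF.^ i) (f GF.^ j)) (QW.*-congˡ {f} (^-+ f i j))

-- The substitution scales coefficient n by (1-w)^n; in a convolution the factors (1-w)^i and
-- (1-w)^(n-i) combine to the same power in every summand.
Φ-square : ∀ m n t → (Φ m S.⋆ Φ m) n t ≡ (L.φ m ℚw.⋆ L.φ m) n * (GF.δ GF.^ n) t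
Φ-square m n t = begin
  (Φ m S.⋆ Φ m) n t
    ≡⟨ GF.Σ≤-apply n (λ i → Φ m i ℚw.⋆ Φ m (n ∸ i)) t ⟩
  ℚΣ.Σ≤ n (λ i → (Φ m i ℚw.⋆ Φ m (n ∸ i)) t)
    ≡⟨ ℚΣ.Σ≤-cong n step ⟩
  ℚΣ.Σ≤ n (λ i → (GF.δ GF.^ n) t * (φ i * φ (n ∸ i)))
    ≡⟨ ℚΣ.Σ≤-*ˡ n ((GF.δ GF.^ n) t) (λ i → φ i * φ (n ∸ i)) ⟨
  (GF.δ GF.^ n) t * (φ ℚw.⋆ φ) n
    ≡⟨ ℚₚ.*-comm ((GF.δ GF.^ n) t) _ ⟩
  (φ ℚw.⋆ φ) n * (GF.δ GF.^ n) t ∎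
  where
  open ≡-Reasoning
  φ : ℕ → ℚ
  φ = L.φ m
  step : ∀ i → i ℕ.≤ n → (Φ m i ℚw.⋆ Φ m (n ∸ i)) t ≡ (GF.δ GF.^ n) t * (φ i * φ (n ∸ i))
  step i i≤n = begin
    (Φ m i ℚw.⋆ Φ m (n ∸ i)) t
      ≡⟨ ℚw.·-⋆-assoc (φ i) (GF.δ GF.^ i) (Φ m (n ∸ i)) t ⟩
    φ i * ((GF.δ GF.^ i) ℚw.⋆ Φ m (n ∸ i)) t
      ≡⟨ cong (φ i *_) (ℚw.⋆-· (φ (n ∸ i)) (GF.δ GF.^ i) (GF.δ GF.^ (n ∸ i)) t) ⟩
    φ i * (φ (n ∸ i) * ((GF.δ GF.^ i) ℚw.⋆ (GF.δ GF.^ (n ∸ i))) t)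
      ≡⟨ cong (λ x → φ i * (φ (n ∸ i) * x)) (trans (^-+ GF.δ i (n ∸ i) t)
         (cong (λ k → (GF.δ GF.^ k) t) (ℕₚ.m+[n∸m]≡n i≤n))) ⟩
    φ i * (φ (n ∸ i) * (GF.δ GF.^ n) t)
      ≡⟨ solve 3 (λ a b x → a :* (b :* x) := x :* (a :* b)) refl (φ i) (φ (n ∸ i)) ((GF.δ GF.^ n) t) ⟩
    (GF.δ GF.^ n) t * (φ i * φ (n ∸ i)) ∎
    where open +-*-Solver

Φ-suc : ∀ m → Φ (suc m) S.≋ (Φ m S.⊞ Φ (suc m) S.⋆ Φ (suc m))
Φ-suc m n t = trans (cong (_* (GF.δ GF.^ n) t) (L.φ-suc m n))
  (trans (ℚₚ.*-distribʳ-+ ((GF.δ GF.^ n) t) (L.φ m n) ((L.φ (suc m) ℚw.⋆ L.φ (suc m)) n))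
    (cong (Φ m n t +_) (sym (Φ-square (suc m) n t))))

Ψ : ℕ → Series
Ψ m n t = const 1ℚ n t - fromℕℚ 2 * Φ m n t

Ψ-Φ : ∀ m → (Ψ m S.⊞ (Φ m S.⊞ Φ m)) S.≋ ZW.1#
Ψ-Φ m n t = trans (cancel (const 1ℚ n t) (Φ m n t)) (const≋C 1ℚ n t)
  where
  open +-*-Solver
  cancel : ∀ a b → (a - fromℕℚ 2 * b) + (b + b) ≡ a
  cancel = solve 2 (λ a b → (a :- con (fromℕℚ 2) :* b) :+ (b :+ b) := a) refl

Ψ-square : ∀ m n t → fromℕℚ 2 * Ψ m n t - const 1ℚ n t ≡ (Ψ (suc m) S.⋆ Ψ (suc m)) n t
Ψ-square m n t = begin
  fromℕℚ 2 * Ψ m n t - const 1ℚ n t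
    ≡⟨ solve 2 (λ a o → con (fromℕℚ 2) :* a :- o := (a :+ a) :- o) refl (Ψ m n t) (const 1ℚ n t) ⟩
  (Ψ m n t + Ψ m n t) - const 1ℚ n t
    ≡⟨ cong₂ _-_ (sym (square-of-1-2p (Ψ (suc m)) (Ψ m) (Φ (suc m)) (Φ m)
         (Ψ-Φ (suc m)) (Ψ-Φ m) (Φ-suc m) n t)) (const≋C 1ℚ n t) ⟩
  ((Ψ (suc m) S.⋆ Ψ (suc m)) n t + ZW.1# n t) - ZW.1# n t
    ≡⟨ solve 2 (λ a o → (a :+ o) :- o := a) refl _ (ZW.1# n t) ⟩
  (Ψ (suc m) S.⋆ Ψ (suc m)) n t ∎
  where
  open ≡-Reasoning
  open +-*-Solver
  open SquareLemma S.PS-commutativeRing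

Ψ-0 : ∀ m → Ψ m 0 ℚw.≋ ℚw.C 1ℚ
Ψ-0 m t = trans (cong (λ x → const 1ℚ 0 t - fromℕℚ 2 * x) (ℚₚ.*-zeroˡ ((GF.δ GF.^ 0) t)))
  (trans (ℚₚ.+-identityʳ (const 1ℚ 0 t)) (const≋C 1ℚ 0 t))

-- The module `Z` has coefficients in ℚ[[w]], so the variable that it calls `w` is z.
zS≋ : zS S.≋ Z.w
zS≋ zero t = refl
zS≋ (suc zero) zero = refl
zS≋ (suc zero) (suc t) = refl
zS≋ (suc (suc n)) t = refl

wS≋ : wS S.≋ S.C GF.w
wS≋ zero zero = refl
wS≋ zero (suc zero) = refl
wS≋ zero (suc (suc t)) = refl
wS≋ (suc n) t = refl

oneMinusW≋ : oneMinusW S.≋ S.C GF.δ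
oneMinusW≋ zero t = cong₂ _-_ (const≋C 1ℚ 0 t) (wS≋ 0 t)
oneMinusW≋ (suc n) t = refl

z[1-w] : (zS ⊛ oneMinusW) S.≋ Φ 0
z[1-w] = ZW.trans (⊛≋⋆ zS oneMinusW) (ZW.trans (ZW.*-cong zS≋ oneMinusW≋) go)
  where
  go : (Z.w S.⋆ S.C GF.δ) S.≋ Φ 0
  go zero t = trans (QW.zeroˡ GF.δ t) (sym (ℚₚ.*-zeroˡ ((GF.δ GF.^ 0) t)))
  go (suc zero) t = trans (Z.w-⋆-suc (S.C GF.δ) 0 t) (trans (sym (QW.*-identityʳ GF.δ t)) (sym (ℚₚ.*-identityˡ ((GF.δ GF.^ 1) t))))
  go (suc (suc n)) t = trans (Z.w-⋆-suc (S.C GF.δ) (suc n) t) (sym (ℚₚ.*-zeroˡ ((GF.δ GF.^ (suc (suc n))) t)))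

ψ≋Ψ : ∀ m → ψ m S.≋ Ψ m
ψ≋Ψ zero n t = cong (λ x → const 1ℚ n t - fromℕℚ 2 * x) (z[1-w] n t)
ψ≋Ψ (suc zero) = sqrtS-unique _ (Ψ 1)
  -- 1 - 4z(1-w) = 2ψ_0 - 1, so ψ_1 already obeys the recursion by which the later ψ_j are defined.
  (λ n t → trans (double (const 1ℚ n t) ((zS ⊛ oneMinusW) n t))
    (trans (cong (λ x → fromℕℚ 2 * x - const 1ℚ n t) (ψ≋Ψ 0 n t)) (Ψ-square 0 n t)))
  (Ψ-0 1)
  where
  open +-*-Solver
  double : ∀ a b → a - fromℕℚ 4 * b ≡ fromℕℚ 2 * (a - fromℕℚ 2 * b) - a
  double = solve 2 (λ a b → a :- con (fromℕℚ 4) :* b := con (fromℕℚ 2) :* (a :- con (fromℕℚ 2) :* b) :- a) refl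
ψ≋Ψ (suc (suc m)) = sqrtS-unique _ (Ψ (suc (suc m)))
  (λ n t → trans (cong (λ x → fromℕℚ 2 * x - const 1ℚ n t) (ψ≋Ψ (suc m) n t)) (Ψ-square (suc m) n t))
  (Ψ-0 (suc (suc m)))

-- Coefficients of the sum over j

geometric : ℚw.PS
geometric = GF.levelledGF 0 0 0

pow-w : ∀ k → pow (const 1ℚ ⊖ oneMinusW) k S.≋ S.C (GF.w GF.^ k)
pow-w zero = const≋C 1ℚ
pow-w (suc k) = ZW.trans (⊛≋⋆ (const 1ℚ ⊖ oneMinusW) (pow (const 1ℚ ⊖ oneMinusW) k))
  (ZW.trans (ZW.*-cong 1-δ (pow-w k)) (ZW.trans (S.C-⋆ GF.w (S.C (GF.w GF.^ k))) C-*))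
  where
  open +-*-Solver
  1-δ : (const 1ℚ ⊖ oneMinusW) S.≋ S.C GF.w
  1-δ n t = trans (solve 2 (λ a b → a :- (a :- b) := b) refl (const 1ℚ n t) (wS n t)) (wS≋ n t)
  C-* : (GF.w S.· S.C (GF.w GF.^ k)) S.≋ S.C (GF.w GF.^ suc k)
  C-* zero t = refl
  C-* (suc n) t = QW.zeroʳ GF.w t

-- `geometric` has all coefficients 1. Writing it as `levelledGF 0 0 0` lets `levelledGF-zero` show
-- that it is inverse to 1 - w.
invS-oneMinusW : invS oneMinusW S.≋ S.C geometric
invS-oneMinusW n t = trans (sumTo≡Σ≤ (n ℕ.+ t) _)
  (trans (ℚΣ.Σ≤-cong (n ℕ.+ t) λ k _ → pow-w k n t) (go n))
  where
  diagonal : ∀ t → ℚΣ.Σ≤ t (λ k → (GF.w GF.^ k) t) ≡ 1ℚ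
  diagonal zero = refl
  diagonal (suc t) = trans (ℚΣ.Σ≤-suc t _) (trans (ℚₚ.+-identityˡ _)
    (trans (ℚΣ.Σ≤-cong t λ k _ → GF.w-⋆-suc (GF.w GF.^ k) t) (diagonal t)))
  go : ∀ n → ℚΣ.Σ≤ (n ℕ.+ t) (λ k → S.C (GF.w GF.^ k) n t) ≡ S.C geometric n t
  go zero = diagonal t
  go (suc n) = ℚΣ.Σ≤-0 (suc n ℕ.+ t)

β : ℕ → ℚw.PS
β n j = L.φ (suc j) (suc n) - L.φ j (suc n)

-- ψ_j - ψ_(j+1) is twice the difference of the Φ's, which absorbs the ½. `divZ` reads order n + 1
-- and so meets (1-w)^(n+1), of which the division by 1 - w leaves (1-w)^n.
term≡ : ∀ j n t → term j n t ≡ β n j * (GF.δ GF.^ n) t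
term≡ j n t = begin
  ½ * (invS oneMinusW ⊛ D) n t
    ≡⟨ cong (½ *_) (⊛≋⋆ (invS oneMinusW) D n t) ⟩
  ½ * (invS oneMinusW S.⋆ D) n t
    ≡⟨ cong (½ *_) (ZW.*-congʳ {D} invS-oneMinusW n t) ⟩
  ½ * (S.C geometric S.⋆ D) n t
    ≡⟨ cong (½ *_) (S.C-⋆ geometric D n t) ⟩
  ½ * (geometric ℚw.⋆ D n) t
    ≡⟨ cong (½ *_) (QW.*-congˡ {geometric} D≋ t) ⟩
  ½ * (geometric ℚw.⋆ ((fromℕℚ 2 * β n j) ℚw.· (GF.δ ℚw.⋆ GF.δ GF.^ n))) t
    ≡⟨ cong (½ *_) (ℚw.⋆-· (fromℕℚ 2 * β n j) geometric (GF.δ ℚw.⋆ GF.δ GF.^ n) t) ⟩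
  ½ * ((fromℕℚ 2 * β n j) * (geometric ℚw.⋆ (GF.δ ℚw.⋆ GF.δ GF.^ n)) t)
    ≡⟨ cong (λ x → ½ * ((fromℕℚ 2 * β n j) * x)) (geometric-δ t) ⟩
  ½ * ((fromℕℚ 2 * β n j) * (GF.δ GF.^ n) t)
    ≡⟨ solve 2 (λ b x → con ½ :* ((con (fromℕℚ 2) :* b) :* x) := b :* x) refl (β n j) ((GF.δ GF.^ n) t) ⟩
  β n j * (GF.δ GF.^ n) t ∎
  where
  open ≡-Reasoning
  open +-*-Solver
  D : Series
  D = divZ (ψ j ⊖ ψ (suc j))
  D≋ : D n ℚw.≋ ((fromℕℚ 2 * β n j) ℚw.· (GF.δ ℚw.⋆ GF.δ GF.^ n))
  D≋ s = trans (cong₂ _-_ (ψ≋Ψ j (suc n) s) (ψ≋Ψ (suc j) (suc n) s))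
    (solve 3 (λ a b x → (con 0ℚ :- con (fromℕℚ 2) :* (a :* x)) :- (con 0ℚ :- con (fromℕℚ 2) :* (b :* x))
       := (con (fromℕℚ 2) :* (b :- a)) :* x) refl (L.φ j (suc n)) (L.φ (suc j) (suc n)) ((GF.δ ℚw.⋆ GF.δ GF.^ n) s))
  geometric-δ : (geometric ℚw.⋆ (GF.δ ℚw.⋆ GF.δ GF.^ n)) ℚw.≋ (GF.δ GF.^ n)
  geometric-δ = QW.trans (QW.sym (ℚw.⋆-assoc geometric GF.δ (GF.δ GF.^ n)))
    (QW.trans (QW.*-congʳ {GF.δ GF.^ n} {geometric ℚw.⋆ GF.δ} {QW.1#}
        (QW.trans (ℚw.⋆-comm geometric GF.δ) (GF.δ-⋆ (GF.levelledGF-zero 0 0))))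
      (QW.*-identityˡ (GF.δ GF.^ n)))

-- The factor (1-w)^n does not depend on j, so the sum over j is a product with `β n` read as a
-- series in w.
wSum-term : ∀ n t → wSum term n t ≡ (β n ℚw.⋆ GF.δ GF.^ n) t
wSum-term n t = trans (sumTo≡Σ≤ t _) (ℚΣ.Σ≤-cong t λ j _ → term≡ j n (t ∸ j))

-- All φ_j, φ_0 = u included, have the same coefficient of u.
wSum-term-0 : ∀ t → wSum term 0 t ≡ 0ℚ
wSum-term-0 t = trans (wSum-term 0 t)
  (trans (QW.*-congʳ {GF.δ GF.^ 0} β≋0 t) (QW.zeroˡ (GF.δ GF.^ 0) t))
  where
  β≋0 : β 0 ℚw.≋ QW.0#
  β≋0 j = trans (cong (λ x → 1ℚ - x) (L.levelled-0 j 0 0)) refl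

-- From order u² on φ_0 contributes nothing, so the differences `β (suc n)` form (1-w) · `Y`. This
-- supplies the factor missing from (1-w)^(n+2).
wSum-term-suc : ∀ n t → wSum term (suc n) t ≡ GF.insertionGF (suc n) 0 0 0 t
wSum-term-suc n t = trans (wSum-term (suc n) t) ((begin
  β (suc n) ℚw.⋆ GF.δ GF.^ suc n                ≈⟨ QW.*-congʳ {GF.δ GF.^ suc n} {β (suc n)} {GF.δ ℚw.⋆ Y} (QW.sym (GF.δ-⋆ Y≋)) ⟩
  GF.δ ℚw.⋆ Y ℚw.⋆ GF.δ GF.^ suc n               ≈⟨ xy∙z≈xz∙y GF.δ Y (GF.δ GF.^ suc n) ⟩
  GF.δ GF.^ suc (suc n) ℚw.⋆ Y                  ≈⟨ GF.δ^-levelledGF (suc n) 0 0 z≤n ⟩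
  GF.insertionGF (suc n) 0 0 0                           ∎) t)
  where
  open import Relation.Binary.Reasoning.Setoid QW.setoid
  open import Algebra.Properties.CommutativeSemigroup QW.*-commutativeSemigroup using (xy∙z≈xz∙y)
  Y : ℚw.PS
  Y = GF.levelledGF (suc n) 0 0
  cancel : ∀ a b → a ≡ (a - b) + b
  cancel = solve 2 (λ a b → a := (a :- b) :+ b) refl
    where open +-*-Solver
  Y≋ : Y ℚw.≋ (β (suc n) ℚw.⊞ GF.w ℚw.⋆ Y)
  Y≋ zero = trans (cancel (Y 0) 0ℚ) (cong (β (suc n) 0 +_) (sym (ℚₚ.*-zeroˡ (Y 0))))
  Y≋ (suc j) = trans (cancel (Y (suc j)) (Y j)) (cong (β (suc n) (suc j) +_) (sym (GF.w-⋆-suc Y j)))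

open import Data.List using (List; []; _∷_; _++_; _ʳ++_; length; reverse; filter; filterᵇ;
  map; concatMap; cartesianProductWith)
open import Data.List.Membership.Propositional using (_∈_; _∉_)
open import Data.List.Membership.Propositional.Properties
open import Data.List.Membership.Propositional.Properties.WithK using (unique∧set⇒bag)
import Data.List.Membership.DecPropositional as DecMembership
import Data.List.Properties as Listₚ
open import Data.List.Relation.Binary.BagAndSetEquality using (∼bag⇒↭)
open import Data.List.Relation.Binary.Permutation.Propositional using (_↭_; ↭-sym)
import Data.List.Relation.Binary.Permutation.Propositional.Properties as ↭ₚ
open import Data.List.Relation.Unary.All as All using (All; []; _∷_)
import Data.List.Relation.Unary.All.Properties as Allₚ
open import Data.List.Relation.Unary.AllPairs using ([]; _∷_)
open import Data.List.Relation.Unary.Any using (here; there)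
open import Data.List.Relation.Unary.Unique.Propositional using (Unique)
import Data.List.Relation.Unary.Unique.Propositional.Properties as Uniqueₚ
open import Data.Nat using (_≤_; _<_; _≡ᵇ_; _≤ᵇ_)
open import Function using (_∘_; mk⇔)
open import Relation.Nullary using (yes; no; ¬_)
open import Relation.Nullary.Decidable using (T?)

-- The effect of a new minimum on the number of passes

≡ᵇ-refl : ∀ n → (n ≡ᵇ n) ≡ true
≡ᵇ-refl zero = refl
≡ᵇ-refl (suc n) = ≡ᵇ-refl n

≡ᵇ-false : ∀ {m n} → m ≢ n → (m ≡ᵇ n) ≡ false
≡ᵇ-false {m} {n} m≢n with m ≡ᵇ n | ℕₚ.≡ᵇ⇒≡ m n
... | false | _ = refl
... | true | eq = ⊥-elim (m≢n (eq _))

popWhile-≢ : ∀ {a k} st → a ≢ k → popWhile (a ∷ st) k ≡ (a ∷ st , k)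
popWhile-≢ st a≢k rewrite ≡ᵇ-false a≢k = refl

popWhile-≡ : ∀ k st → popWhile (k ∷ st) k ≡ popWhile st (suc k)
popWhile-≡ k st rewrite ≡ᵇ-refl k = refl

popWhile-ʳ++ : ∀ {k P} st → All (_≢ k) P → popWhile st k ≡ (st , k) → popWhile (P ʳ++ st) k ≡ (P ʳ++ st , k)
popWhile-ʳ++ st [] eq = eq
popWhile-ʳ++ st (a≢k ∷ P≢k) eq = popWhile-ʳ++ _ P≢k (popWhile-≢ st a≢k)

resume : List ℕ → List ℕ × ℕ → List ℕ × ℕ
resume Q (st , k) = pushAll Q st k

pushAll-skip : ∀ {k P} Q st → All (_≢ k) P → pushAll (P ++ Q) st k ≡ pushAll Q (P ʳ++ st) k
pushAll-skip Q st [] = refl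
pushAll-skip {k} Q st (a≢k ∷ P≢k) rewrite popWhile-≢ st a≢k = pushAll-skip Q _ P≢k

pushAll-min : ∀ x Q st → pushAll (x ∷ Q) st x ≡ resume Q (popWhile st (suc x))
pushAll-min x Q st = cong (resume Q) (popWhile-≡ x st)

pushAll-insert : ∀ {x P} Q → All (_≢ x) P →
                 pushAll (P ++ x ∷ Q) [] x ≡ resume Q (popWhile (P ʳ++ []) (suc x))
pushAll-insert {x} {P} Q P≢x = trans (pushAll-skip (x ∷ Q) [] P≢x) (pushAll-min x Q (P ʳ++ []))

toInput : List ℕ × ℕ → List ℕ × ℕ
toInput (st , k) = reverse st , k

-- x leaves the stack as soon as it is pushed, before `suc x` has been met.
pass-before : ∀ {x P} Q → All (_≢ x) P → All (_≢ suc x) P → pass (P ++ x ∷ Q) x ≡ pass (P ++ Q) (suc x)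
pass-before {x} {P} Q P≢x P≢sx = cong toInput (begin
  pushAll (P ++ x ∷ Q) [] x                ≡⟨ pushAll-insert Q P≢x ⟩
  resume Q (popWhile (P ʳ++ []) (suc x))   ≡⟨ cong (resume Q) (popWhile-ʳ++ [] P≢sx refl) ⟩
  pushAll Q (P ʳ++ []) (suc x)             ≡⟨ pushAll-skip Q [] P≢sx ⟨
  pushAll (P ++ Q) [] (suc x)              ∎)
  where open ≡-Reasoning

-- Popping x exposes `suc x` on top of the stack, so it is output as if it had just been pushed.
pass-after : ∀ {x A} Q → All (_≢ x) A → All (_≢ suc x) A →
             pass (A ++ suc x ∷ x ∷ Q) x ≡ pass (A ++ suc x ∷ Q) (suc x)
pass-after {x} {A} Q A≢x A≢sx = cong toInput (begin
  pushAll (A ++ suc x ∷ x ∷ Q) [] x            ≡⟨ pushAll-skip (suc x ∷ x ∷ Q) [] A≢x ⟩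
  pushAll (suc x ∷ x ∷ Q) (A ʳ++ []) x         ≡⟨ cong (resume (x ∷ Q)) (popWhile-≢ {suc x} {x} (A ʳ++ []) ℕₚ.1+n≢n) ⟩
  pushAll (x ∷ Q) (suc x ∷ A ʳ++ []) x         ≡⟨ pushAll-min x Q (suc x ∷ A ʳ++ []) ⟩
  resume Q (popWhile (suc x ∷ A ʳ++ []) (suc x)) ≡⟨⟩
  pushAll (suc x ∷ Q) (A ʳ++ []) (suc x)       ≡⟨ pushAll-skip (suc x ∷ Q) [] A≢sx ⟨
  pushAll (A ++ suc x ∷ Q) [] (suc x)          ∎)
  where open ≡-Reasoning

-- `suc x` may occur in `P`, where `c` covers it, but not in `D`; thus x is the only output.
pass-beyond : ∀ {x P c} D → All (_≢ x) P → c ≢ x → c ≢ suc x → All (_≢ suc x) D →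
              pass (P ++ c ∷ x ∷ D) x ≡ (P ++ c ∷ D , suc x)
pass-beyond {x} {P} {c} D P≢x c≢x c≢sx D≢sx = trans (cong toInput (begin
  pushAll (P ++ c ∷ x ∷ D) [] x                ≡⟨ pushAll-skip (c ∷ x ∷ D) [] P≢x ⟩
  pushAll (c ∷ x ∷ D) (P ʳ++ []) x             ≡⟨ cong (resume (x ∷ D)) (popWhile-≢ (P ʳ++ []) c≢x) ⟩
  pushAll (x ∷ D) (c ∷ P ʳ++ []) x             ≡⟨ pushAll-min x D (c ∷ P ʳ++ []) ⟩
  resume D (popWhile (c ∷ P ʳ++ []) (suc x))   ≡⟨ cong (resume D) (popWhile-≢ (P ʳ++ []) c≢sx) ⟩
  pushAll D (c ∷ P ʳ++ []) (suc x)             ≡⟨ cong (λ L → pushAll L (c ∷ P ʳ++ []) (suc x)) (Listₚ.++-identityʳ D) ⟨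
  pushAll (D ++ []) (c ∷ P ʳ++ []) (suc x)     ≡⟨ pushAll-skip [] (c ∷ P ʳ++ []) D≢sx ⟩
  (D ʳ++ (c ∷ P ʳ++ []) , suc x)               ≡⟨ cong (_, suc x) (Listₚ.++-ʳ++ P) ⟨
  (reverse (P ++ c ∷ D) , suc x)               ∎))
  (cong (_, suc x) (Listₚ.reverse-involutive (P ++ c ∷ D)))
  where open ≡-Reasoning

-- Pass counts without fuel. Nonemptiness is a length condition because the inputs arise as
-- `ins i x π`, which need not reduce to a cons.
data Runs : List ℕ → ℕ → ℕ → Set where
  done : ∀ {k} → Runs [] k 0
  step : ∀ {π k c} → 1 ≤ length π → uncurry Runs (pass π k) c → Runs π k (suc c)

Runs⇒passesFrom : ∀ {π k c} f → Runs π k c → c ≤ f → passesFrom f π k ≡ c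
Runs⇒passesFrom zero done _ = refl
Runs⇒passesFrom (suc f) done _ = refl
Runs⇒passesFrom {[]} _ (step () _) _
Runs⇒passesFrom {_ ∷ _} (suc f) (step _ r) (s≤s c≤f) = cong suc (Runs⇒passesFrom f r c≤f)

Runs-pass : ∀ {π π′ k k′ c} → 1 ≤ length π′ → pass π′ k′ ≡ pass π k → Runs π k (suc c) → Runs π′ k′ (suc c)
Runs-pass 1≤ eq (step _ r) = step 1≤ (subst (λ s → uncurry Runs s _) (sym eq) r)

ins : ℕ → ℕ → List ℕ → List ℕ
ins zero x π = x ∷ π
ins (suc i) x [] = x ∷ []
ins (suc i) x (a ∷ π) = a ∷ ins i x π

ins-++ : ∀ x P Q → ins (length P) x (P ++ Q) ≡ P ++ x ∷ Q
ins-++ x [] Q = refl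
ins-++ x (a ∷ P) Q = cong (a ∷_) (ins-++ x P Q)

-- Insertion places in `A ++ v ∷ B`, sorted according to the three lemmas on `pass`.
data Gap (v : ℕ) (A B : List ℕ) : ℕ → Set where
  before : ∀ P A′ → A ≡ P ++ A′ → Gap v A B (length P)
  after  : Gap v A B (suc (length A))
  beyond : ∀ C c D → B ≡ C ++ c ∷ D → Gap v A B (suc (length A ℕ.+ suc (length C)))

split : ∀ {v A} B i → i < length B → Gap v A B (suc (length A ℕ.+ suc i))
split {v} {A} B i i<B = subst (λ j → Gap v A B (suc (length A ℕ.+ suc j))) (len B i i<B)
  (beyond (front B i i<B) (at B i i<B) (back B i i<B) (eq B i i<B))
  where
  front : ∀ B i → i < length B → List ℕ
  front (b ∷ B) zero _ = []
  front (b ∷ B) (suc i) (s≤s i<B) = b ∷ front B i i<B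
  at : ∀ B i → i < length B → ℕ
  at (b ∷ B) zero _ = b
  at (b ∷ B) (suc i) (s≤s i<B) = at B i i<B
  back : ∀ B i → i < length B → List ℕ
  back (b ∷ B) zero _ = B
  back (b ∷ B) (suc i) (s≤s i<B) = back B i i<B
  eq : ∀ B i i<B → B ≡ front B i i<B ++ at B i i<B ∷ back B i i<B
  eq (b ∷ B) zero _ = refl
  eq (b ∷ B) (suc i) (s≤s i<B) = cong (b ∷_) (eq B i i<B)
  len : ∀ B i i<B → length (front B i i<B) ≡ i
  len (b ∷ B) zero _ = refl
  len (b ∷ B) (suc i) (s≤s i<B) = cong suc (len B i i<B)

gap : ∀ v A B i → i ≤ length (A ++ v ∷ B) → Gap v A B i
gap v [] B zero _ = before [] [] refl
gap v [] B (suc zero) _ = after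
gap v [] B (suc (suc i)) (s≤s i<B) = split {v} {[]} B i i<B
gap v (a ∷ A) B zero _ = before [] (a ∷ A) refl
gap v (a ∷ A) B (suc i) (s≤s i≤) with gap v A B i i≤
... | before P A′ refl = before (a ∷ P) A′ refl
... | after = after
... | beyond C c D eq = beyond C c D eq

-- The invariant of inserting n, n-1, ..., 1 in turn: x is the minimum of π and stands at position p, and
-- sorting π takes c + 1 passes.
data State (x : ℕ) : ℕ → ℕ → ℕ → List ℕ → Set where
  empty : State x 0 0 0 []
  full  : ∀ {k p c π} A B → π ≡ A ++ x ∷ B → length π ≡ k → p ≡ suc (length A) →
          All (x <_) A → All (x <_) B → Runs π x (suc c) → suc c ≤ k → State x k p c π

length-ins : ∀ i x π → length (ins i x π) ≡ suc (length π)
length-ins zero x π = refl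
length-ins (suc i) x [] = refl
length-ins (suc i) x (a ∷ π) = cong suc (length-ins i x π)

private
  <⇒≢ᴬ : ∀ {x A} → All (suc x <_) A → All (_≢ x) A
  <⇒≢ᴬ = All.map λ sx<a a≡x → ℕₚ.<⇒≢ (ℕₚ.<-trans (ℕₚ.n<1+n _) sx<a) (sym a≡x)

  <⇒≢sᴬ : ∀ {x A} → All (suc x <_) A → All (_≢ suc x) A
  <⇒≢sᴬ = All.map λ sx<a a≡sx → ℕₚ.<⇒≢ sx<a (sym a≡sx)

  weaken : ∀ {x A} → All (suc x <_) A → All (x <_) A
  weaken = All.map (ℕₚ.<-trans (ℕₚ.n<1+n _))

-- The old minimum has `length A` = p - 1 predecessors, so i ≤ p covers `before` and `after`. In
-- these cases the first pass ends exactly as before; in the case `beyond` one extra pass reproduces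
-- the old list.
insert-min : ∀ {x k p c π} → State (suc x) k p c π → ∀ i → i ≤ k →
             State x (suc k) (suc i) (if i ≤ᵇ p then c else suc c) (ins i x π)
insert-min {x} empty zero _ = full [] [] refl refl refl [] []
  (step (s≤s z≤n) (subst (λ s → uncurry Runs s 0) (sym pass-singleton) done)) (s≤s z≤n)
  where
  pass-singleton : pass (x ∷ []) x ≡ ([] , suc x)
  pass-singleton = cong toInput (pushAll-min x [] [])
insert-min {x} {c = c} (full A B refl refl refl A> B> r c<k) i i≤k with gap (suc x) A B i i≤k
... | before P A′ refl
    rewrite ≤ᵇ-true {length P} {suc (length (P ++ A′))}
              (ℕₚ.m≤n⇒m≤1+n (subst (length P ≤_) (sym (Listₚ.length-++ P)) (ℕₚ.m≤m+n (length P) (length A′))))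
          | Listₚ.++-assoc P A′ (suc x ∷ B)
  = full P Q (ins-++ x P Q) (length-ins (length P) x (P ++ Q)) refl (weaken P>)
      (Allₚ.++⁺ (weaken A′>) (ℕₚ.n<1+n x ∷ weaken B>))
      (Runs-pass (subst (1 ≤_) (sym (length-ins (length P) x (P ++ Q))) (s≤s z≤n))
        (trans (cong (λ L → pass L x) (ins-++ x P Q)) (pass-before Q (<⇒≢ᴬ P>) (<⇒≢sᴬ P>))) r)
      (ℕₚ.m≤n⇒m≤1+n c<k)
  where
  Q = A′ ++ suc x ∷ B
  P> = Allₚ.++⁻ˡ P A>
  A′> = Allₚ.++⁻ʳ P A>
... | after
    rewrite ≤ᵇ-true {suc (length A)} {suc (length A)} ℕₚ.≤-refl
  = full P B ins≡ (length-ins (suc (length A)) x (A ++ suc x ∷ B)) (cong suc (sym length-P))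
      (Allₚ.++⁺ (weaken A>) (ℕₚ.n<1+n x ∷ [])) (weaken B>)
      (Runs-pass (subst (1 ≤_) (sym (length-ins (suc (length A)) x (A ++ suc x ∷ B))) (s≤s z≤n))
        (trans (cong (λ L → pass L x) (trans ins≡ (Listₚ.++-assoc A (suc x ∷ []) (x ∷ B))))
          (pass-after B (<⇒≢ᴬ A>) (<⇒≢sᴬ A>))) r)
      (ℕₚ.m≤n⇒m≤1+n c<k)
  where
  P = A ++ suc x ∷ []
  length-P : length P ≡ suc (length A)
  length-P = trans (Listₚ.length-++ A) (ℕₚ.+-comm (length A) 1)
  ins≡ : ins (suc (length A)) x (A ++ suc x ∷ B) ≡ P ++ x ∷ B
  ins≡ = trans (cong (ins (suc (length A)) x) (sym (Listₚ.++-assoc A (suc x ∷ []) B)))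
    (subst (λ j → ins j x (P ++ B) ≡ P ++ x ∷ B) length-P (ins-++ x P B))
... | beyond C d D refl
    rewrite ≤ᵇ-false {suc (length A ℕ.+ suc (length C))} {suc (length A)}
              (s≤s (ℕₚ.m<m+n (length A) (s≤s z≤n)))
  = full P D ins≡ (length-ins j x π) (cong suc (sym length-P))
      (Allₚ.++⁺ (weaken A>) (ℕₚ.n<1+n x ∷ weaken Cd>)) (weaken D>)
      (step (subst (1 ≤_) (sym (length-ins j x π)) (s≤s z≤n))
        (subst (λ s → uncurry Runs s (suc c)) (sym pass≡π) r))
      (s≤s c<k)
  where
  π = A ++ suc x ∷ C ++ d ∷ D
  j = suc (length A ℕ.+ suc (length C))
  P₁ = A ++ suc x ∷ C
  P = A ++ suc x ∷ (C ++ d ∷ [])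
  C> = Allₚ.++⁻ˡ C B>
  d> = All.head (Allₚ.++⁻ʳ C B>)
  D> = All.tail (Allₚ.++⁻ʳ C B>)
  Cd> = Allₚ.++⁺ C> (d> ∷ [])
  assoc : ∀ E → P ++ E ≡ P₁ ++ d ∷ E
  assoc E = trans (Listₚ.++-assoc A _ E)
    (trans (cong (λ L → A ++ suc x ∷ L) (Listₚ.++-assoc C (d ∷ []) E)) (sym (Listₚ.++-assoc A (suc x ∷ C) (d ∷ E))))
  length-P : length P ≡ j
  length-P = trans (Listₚ.length-++ A) (trans (cong (λ m → length A ℕ.+ suc m)
    (trans (Listₚ.length-++ C) (ℕₚ.+-comm (length C) 1))) (ℕₚ.+-suc (length A) (suc (length C))))
  π≡ : P₁ ++ d ∷ D ≡ π
  π≡ = Listₚ.++-assoc A (suc x ∷ C) (d ∷ D)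
  ins≡ : ins j x π ≡ P ++ x ∷ D
  ins≡ = trans (cong (ins j x) (trans (sym π≡) (sym (assoc D))))
    (subst (λ m → ins m x (P ++ D) ≡ P ++ x ∷ D) length-P (ins-++ x P D))
  P₁≢x : All (_≢ x) P₁
  P₁≢x = Allₚ.++⁺ (<⇒≢ᴬ A>) (ℕₚ.1+n≢n ∷ <⇒≢ᴬ C>)
  pass≡π : pass (ins j x π) x ≡ (π , suc x)
  pass≡π = trans (cong (λ L → pass L x) (trans ins≡ (assoc (x ∷ D))))
    (trans (pass-beyond D P₁≢x (All.head (<⇒≢ᴬ (d> ∷ []))) (All.head (<⇒≢sᴬ (d> ∷ []))) (<⇒≢sᴬ D>))
      (cong (_, suc x) π≡))

State⇒tier : ∀ {x c k p π} → State x k p c π → x ≡ 1 → tier π ≡ c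
State⇒tier empty _ = refl
State⇒tier (full _ _ _ refl _ _ _ r c<k) refl = cong ℕ.pred (Runs⇒passesFrom _ r c<k)

-- Permutations as iterated insertions

module _ {a} {A : Set a} where

  -- Concatenation in the shape of `Σ≤`, so that counting turns it into that sum.
  gather : ℕ → (ℕ → List A) → List A
  gather zero F = F 0
  gather (suc k) F = gather k F ++ F (suc k)

  ∈-gather⁺ : ∀ {v} k F i → i ≤ k → v ∈ F i → v ∈ gather k F
  ∈-gather⁺ zero F zero z≤n v∈ = v∈
  ∈-gather⁺ (suc k) F i i≤ v∈ with ℕₚ.m≤n⇒m<n∨m≡n i≤
  ... | inj₁ (s≤s i≤k) = ∈-++⁺ˡ (∈-gather⁺ k F i i≤k v∈)
  ... | inj₂ refl = ∈-++⁺ʳ (gather k F) v∈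

  ∈-gather⁻ : ∀ {v} k F → v ∈ gather k F → ∃ λ i → i ≤ k × v ∈ F i
  ∈-gather⁻ zero F v∈ = 0 , z≤n , v∈
  ∈-gather⁻ (suc k) F v∈ with ∈-++⁻ (gather k F) v∈
  ... | inj₁ v∈ˡ = let i , i≤k , v∈Fi = ∈-gather⁻ k F v∈ˡ in i , ℕₚ.m≤n⇒m≤1+n i≤k , v∈Fi
  ... | inj₂ v∈ʳ = suc k , ℕₚ.≤-refl , v∈ʳ

  gather-unique : ∀ k F → (∀ i → i ≤ k → Unique (F i)) →
                  (∀ {v} i j → i ≤ k → j ≤ k → v ∈ F i → v ∈ F j → i ≡ j) → Unique (gather k F)
  gather-unique zero F u d = u 0 z≤n
  gather-unique (suc k) F u d = Uniqueₚ.++⁺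
    (gather-unique k F (λ i i≤k → u i (ℕₚ.m≤n⇒m≤1+n i≤k))
      λ i j i≤k j≤k → d i j (ℕₚ.m≤n⇒m≤1+n i≤k) (ℕₚ.m≤n⇒m≤1+n j≤k))
    (u (suc k) ℕₚ.≤-refl)
    λ (v∈ˡ , v∈ʳ) → let i , i≤k , v∈Fi = ∈-gather⁻ k F v∈ˡ in
      ℕₚ.<⇒≢ (s≤s i≤k) (d i (suc k) (ℕₚ.m≤n⇒m≤1+n i≤k) ℕₚ.≤-refl v∈Fi v∈ʳ)

  Unique-⊆-length : ∀ {xs ys : List A} → Unique xs → (∀ {v} → v ∈ xs → v ∈ ys) → length xs ≤ length ys
  Unique-⊆-length [] _ = z≤n
  Unique-⊆-length {x ∷ xs} (x≢ ∷ u) xs⊆ with ∈-∃++ (xs⊆ (here refl))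
  ... | ys , zs , refl = subst (suc (length xs) ≤_) (sym (↭ₚ.↭-length (↭ₚ.shift x ys zs)))
    (s≤s (Unique-⊆-length u λ v∈xs → drop-x v∈xs (↭ₚ.∈-resp-↭ (↭ₚ.shift x ys zs) (xs⊆ (there v∈xs)))))
    where
    drop-x : ∀ {v} → v ∈ xs → v ∈ x ∷ ys ++ zs → v ∈ ys ++ zs
    drop-x v∈xs (here refl) = ⊥-elim (All.lookup x≢ v∈xs refl)
    drop-x _ (there v∈) = v∈

  Unique-length-filterᵇ : ∀ (P : A → Bool) {xs ys : List A} → Unique xs → Unique ys →
    (∀ {v} → v ∈ xs → v ∈ ys) → (∀ {v} → v ∈ ys → v ∈ xs) → length (filterᵇ P xs) ≡ length (filterᵇ P ys)
  Unique-length-filterᵇ P u u′ f g = ↭ₚ.↭-length (∼bag⇒↭ (unique∧set⇒bag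
    (Uniqueₚ.filter⁺ (T? ∘ P) u) (Uniqueₚ.filter⁺ (T? ∘ P) u′)
    (mk⇔ (restrict f) (restrict g))))
    where
    restrict : ∀ {xs ys : List A} → (∀ {v} → v ∈ xs → v ∈ ys) → ∀ {v} → v ∈ filterᵇ P xs → v ∈ filterᵇ P ys
    restrict f v∈ = let v∈xs , Pv = ∈-filter⁻ (T? ∘ P) v∈ in ∈-filter⁺ (T? ∘ P) (f v∈xs) Pv

ext : ℕ → ℕ → List ℕ → List (List ℕ)
ext zero k π = π ∷ []
ext (suc n) k π = gather k λ i → ext n (suc k) (ins i (suc n) π)

ins-↭ : ∀ i x π → ins i x π ↭ x ∷ π
ins-↭ zero x π = _↭_.refl
ins-↭ (suc i) x [] = _↭_.refl
ins-↭ (suc i) x (a ∷ π) = _↭_.trans (_↭_.prep a (ins-↭ i x π)) (_↭_.swap a x _↭_.refl)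

ins-injective : ∀ {x π} i j → x ∉ π → i ≤ length π → j ≤ length π → ins i x π ≡ ins j x π → i ≡ j
ins-injective zero zero _ _ _ _ = refl
ins-injective {π = a ∷ π} zero (suc j) x∉ _ _ eq = ⊥-elim (x∉ (here (Listₚ.∷-injectiveˡ eq)))
ins-injective {π = a ∷ π} (suc i) zero x∉ _ _ eq = ⊥-elim (x∉ (here (sym (Listₚ.∷-injectiveˡ eq))))
ins-injective {π = a ∷ π} (suc i) (suc j) x∉ (s≤s i≤) (s≤s j≤) eq =
  cong suc (ins-injective i j (x∉ ∘ there) i≤ j≤ (Listₚ.∷-injectiveʳ eq))

-- Undoes insertions: the entries greater than n form the list that was present before n, ..., 1
-- were inserted.
above : ℕ → List ℕ → List ℕ
above n = filter (n ℕ.<?_)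

above-accept : ∀ {n a} σ → n < a → above n (a ∷ σ) ≡ a ∷ above n σ
above-accept {n} σ = Listₚ.filter-accept (n ℕ.<?_)

above-reject : ∀ {n a} σ → ¬ n < a → above n (a ∷ σ) ≡ above n σ
above-reject {n} σ = Listₚ.filter-reject (n ℕ.<?_)

above-above : ∀ n σ → above (suc n) (above n σ) ≡ above (suc n) σ
above-above n [] = refl
above-above n (a ∷ σ) with n ℕ.<? a | suc n ℕ.<? a
... | yes n<a | yes sn<a
    rewrite above-accept σ n<a | above-accept σ sn<a | above-accept (above n σ) sn<a = cong (a ∷_) (above-above n σ)
... | yes n<a | no sn≮a
    rewrite above-accept σ n<a | above-reject σ sn≮a | above-reject (above n σ) sn≮a = above-above n σ
... | no n≮a | yes sn<a = ⊥-elim (n≮a (ℕₚ.<-trans (ℕₚ.n<1+n n) sn<a))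
... | no n≮a | no sn≮a rewrite above-reject σ n≮a | above-reject σ sn≮a = above-above n σ

above-ins : ∀ n i π → All (suc n <_) π → above (suc n) (ins i (suc n) π) ≡ π
above-ins n zero π π> = trans (Listₚ.filter-reject (suc n ℕ.<?_) (ℕₚ.<-irrefl refl)) (Listₚ.filter-all (suc n ℕ.<?_) π>)
above-ins n (suc i) [] [] = Listₚ.filter-reject (suc n ℕ.<?_) (ℕₚ.<-irrefl refl)
above-ins n (suc i) (a ∷ π) (a> ∷ π>) = trans (Listₚ.filter-accept (suc n ℕ.<?_) a>) (cong (a ∷_) (above-ins n i π π>))

ins-> : ∀ n i {π} → All (suc n <_) π → All (n <_) (ins i (suc n) π)
ins-> n i {π} π> = ↭ₚ.All-resp-↭ (↭-sym (ins-↭ i (suc n) π)) (ℕₚ.n<1+n n ∷ All.map (ℕₚ.<-trans (ℕₚ.n<1+n n)) π>)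

-- The final list determines every intermediate one; this makes the branches of `ext` disjoint.
∈-ext⇒above : ∀ n k {π σ} → All (n <_) π → σ ∈ ext n k π → above n σ ≡ π
∈-ext⇒above zero k π> (here refl) = Listₚ.filter-all (0 ℕ.<?_) π>
∈-ext⇒above (suc n) k {π} {σ} π> σ∈ with ∈-gather⁻ k _ σ∈
... | i , i≤k , σ∈ᵢ = begin
  above (suc n) σ                   ≡⟨ above-above n σ ⟨
  above (suc n) (above n σ)         ≡⟨ cong (above (suc n)) (∈-ext⇒above n (suc k) (ins-> n i π>) σ∈ᵢ) ⟩
  above (suc n) (ins i (suc n) π)   ≡⟨ above-ins n i π π> ⟩
  π                                 ∎
  where open ≡-Reasoning

>⇒∉ : ∀ {n π} → All (n <_) π → n ∉ π
>⇒∉ π> n∈ = ℕₚ.<-irrefl refl (All.lookup π> n∈)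

ext-unique : ∀ n k {π} → All (n <_) π → length π ≡ k → Unique (ext n k π)
ext-unique zero k _ _ = [] ∷ []
ext-unique (suc n) k {π} π> refl = gather-unique k _
  (λ i _ → ext-unique n (suc k) (ins-> n i π>) (length-ins i (suc n) π))
  λ i j i≤k j≤k σ∈ᵢ σ∈ⱼ → ins-injective i j (>⇒∉ π>) i≤k j≤k
    (trans (sym (∈-ext⇒above n (suc k) (ins-> n i π>) σ∈ᵢ)) (∈-ext⇒above n (suc k) (ins-> n j π>) σ∈ⱼ))

record IsPerm (N : ℕ) (σ : List ℕ) : Set where
  constructor isPerm
  field
    unique  : Unique σ
    entries : All (λ a → 1 ≤ a × a ≤ N) σ
    size    : length σ ≡ N

open IsPerm

Unique-ins : ∀ i {x π} → x ∉ π → Unique π → Unique (ins i x π)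
Unique-ins zero x∉ u = Allₚ.¬Any⇒All¬ _ x∉ ∷ u
Unique-ins (suc i) {π = []} x∉ u = [] ∷ []
Unique-ins (suc i) {x} {a ∷ π} x∉ (a≢ ∷ u) =
  ↭ₚ.All-resp-↭ (↭-sym (ins-↭ i x π)) ((λ a≡x → x∉ (here (sym a≡x))) ∷ a≢) ∷ Unique-ins i (x∉ ∘ there) u

∈-ext⇒IsPerm : ∀ {N} n k {π σ} → Unique π → All (λ a → n < a × a ≤ N) π → length π ≡ k → n ℕ.+ k ≡ N →
               σ ∈ ext n k π → IsPerm N σ
∈-ext⇒IsPerm zero k u r refl refl (here refl) = isPerm u r refl
∈-ext⇒IsPerm {N} (suc n) k {π} u r refl eq σ∈ with ∈-gather⁻ k _ σ∈
... | i , _ , σ∈ᵢ = ∈-ext⇒IsPerm n (suc k)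
  (Unique-ins i (>⇒∉ (All.map proj₁ r)) u)
  (↭ₚ.All-resp-↭ (↭-sym (ins-↭ i (suc n) π))
    ((ℕₚ.n<1+n n , subst (suc n ≤_) eq (ℕₚ.m≤m+n (suc n) k)) ∷
      All.map (λ (n<a , a≤N) → ℕₚ.<-trans (ℕₚ.n<1+n n) n<a , a≤N) r))
  (length-ins i (suc n) π) (trans (ℕₚ.+-suc n k) eq) σ∈ᵢ

above-suc : ∀ n {σ} → suc n ∉ σ → above n σ ≡ above (suc n) σ
above-suc n {[]} _ = refl
above-suc n {a ∷ σ} x∉ with n ℕ.<? a | suc n ℕ.<? a
... | yes n<a | yes sn<a rewrite above-accept σ n<a | above-accept σ sn<a = cong (a ∷_) (above-suc n (x∉ ∘ there))
... | yes n<a | no sn≮a = ⊥-elim (x∉ (here (sym (ℕₚ.≤-antisym (ℕₚ.≮⇒≥ sn≮a) n<a))))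
... | no n≮a | yes sn<a = ⊥-elim (n≮a (ℕₚ.<-trans (ℕₚ.n<1+n n) sn<a))
... | no n≮a | no sn≮a rewrite above-reject σ n≮a | above-reject σ sn≮a = above-suc n (x∉ ∘ there)

above-∈ : ∀ n {σ} → Unique σ → suc n ∈ σ →
          ∃ λ i → i ≤ length (above (suc n) σ) × above n σ ≡ ins i (suc n) (above (suc n) σ)
above-∈ n {a ∷ σ} (a≢ ∷ u) (here refl) = 0 , z≤n , (begin
  above n (suc n ∷ σ)                   ≡⟨ Listₚ.filter-accept (n ℕ.<?_) (ℕₚ.n<1+n n) ⟩
  suc n ∷ above n σ                     ≡⟨ cong (suc n ∷_) (above-suc n (λ x∈ → All.lookup a≢ x∈ refl)) ⟩
  suc n ∷ above (suc n) σ               ≡⟨ cong (suc n ∷_) (Listₚ.filter-reject (suc n ℕ.<?_) (ℕₚ.<-irrefl refl)) ⟨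
  suc n ∷ above (suc n) (suc n ∷ σ)     ∎)
  where open ≡-Reasoning
above-∈ n {a ∷ σ} (a≢ ∷ u) (there x∈) with above-∈ n u x∈ | n ℕ.<? a | suc n ℕ.<? a
... | i , i≤ , eq | yes n<a | yes sn<a rewrite above-accept σ n<a | above-accept σ sn<a = suc i , s≤s i≤ , cong (a ∷_) eq
... | i , i≤ , eq | yes n<a | no sn≮a = ⊥-elim (All.lookup a≢ x∈ (ℕₚ.≤-antisym (ℕₚ.≮⇒≥ sn≮a) n<a))
... | i , i≤ , eq | no n≮a | yes sn<a = ⊥-elim (n≮a (ℕₚ.<-trans (ℕₚ.n<1+n n) sn<a))
... | i , i≤ , eq | no n≮a | no sn≮a rewrite above-reject σ n≮a | above-reject σ sn≮a = i , i≤ , eq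

∈-oneToN : ∀ {a} n → 1 ≤ a → a ≤ n → a ∈ oneToN n
∈-oneToN zero (s≤s _) ()
∈-oneToN (suc n) 1≤a a≤ with ℕₚ.m≤n⇒m<n∨m≡n a≤
... | inj₁ (s≤s a≤n) = ∈-++⁺ˡ (∈-oneToN n 1≤a a≤n)
... | inj₂ refl = ∈-++⁺ʳ (oneToN n) (here refl)

oneToN-bounds : ∀ n → All (λ a → 1 ≤ a × a ≤ n) (oneToN n)
oneToN-bounds zero = []
oneToN-bounds (suc n) = Allₚ.++⁺ (All.map (λ (l , u) → l , ℕₚ.m≤n⇒m≤1+n u) (oneToN-bounds n)) ((s≤s z≤n , ℕₚ.≤-refl) ∷ [])

oneToN-unique : ∀ n → Unique (oneToN n)
oneToN-unique zero = []
oneToN-unique (suc n) = Uniqueₚ.++⁺ (oneToN-unique n) ([] ∷ [])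
  λ { (v∈ , here refl) → ℕₚ.<-irrefl refl (proj₂ (All.lookup (oneToN-bounds n) v∈)) }

length-oneToN : ∀ n → length (oneToN n) ≡ n
length-oneToN zero = refl
length-oneToN (suc n) = trans (Listₚ.length-++ (oneToN n)) (trans (ℕₚ.+-comm (length (oneToN n)) 1) (cong suc (length-oneToN n)))

-- Pigeonhole: if a were missing, `a ∷ σ` would be N + 1 distinct values among 1, ..., N.
IsPerm-surjective : ∀ {N σ a} → IsPerm N σ → 1 ≤ a → a ≤ N → a ∈ σ
IsPerm-surjective {N} {σ} {a} p 1≤a a≤N with a ∈? σ
  where open DecMembership ℕₚ._≟_
... | yes a∈ = a∈
... | no a∉ = ⊥-elim (ℕₚ.<-irrefl (trans (size p) (sym (length-oneToN N)))
  (Unique-⊆-length {xs = a ∷ σ} (Allₚ.¬Any⇒All¬ _ a∉ ∷ unique p)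
    λ { (here refl) → ∈-oneToN N 1≤a a≤N
      ; (there v∈) → uncurry (∈-oneToN N) (All.lookup (entries p) v∈) }))

IsPerm⇒∈-ext : ∀ {N σ} → IsPerm N σ → ∀ n → n ≤ N → σ ∈ ext n (length (above n σ)) (above n σ)
IsPerm⇒∈-ext {σ = σ} p zero _ rewrite Listₚ.filter-all (0 ℕ.<?_) (All.map proj₁ (entries p)) = here refl
IsPerm⇒∈-ext {σ = σ} p (suc n) n<N with above-∈ n (unique p) (IsPerm-surjective p (s≤s z≤n) n<N)
... | i , i≤ , eq = ∈-gather⁺ (length (above (suc n) σ)) _ i i≤
  (subst (λ k → σ ∈ ext n k (ins i (suc n) (above (suc n) σ))) (length-ins i (suc n) _)
    (subst (λ L → σ ∈ ext n (length L) L) eq (IsPerm⇒∈-ext p n (ℕₚ.<⇒≤ n<N))))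

IsPerm⇒∈-ext-[] : ∀ {N σ} → IsPerm N σ → σ ∈ ext N 0 []
IsPerm⇒∈-ext-[] {N} {σ} p = subst (λ L → σ ∈ ext N (length L) L)
  (Listₚ.filter-none (N ℕ.<?_) (All.map (λ (_ , a≤N) → ℕₚ.≤⇒≯ a≤N) (entries p))) (IsPerm⇒∈-ext p N ℕₚ.≤-refl)

-- The enumeration `perms` lists each permutation once

wordsOver≡ : ∀ A k → wordsOver A (suc k) ≡ cartesianProductWith _∷_ A (wordsOver A k)
wordsOver≡ A k = go A
  where
  go : ∀ B → concatMap (λ a → map (a ∷_) (wordsOver A k)) B ≡ cartesianProductWith _∷_ B (wordsOver A k)
  go [] = refl
  go (b ∷ B) = cong (map (b ∷_) (wordsOver A k) ++_) (go B)

wordsOver-unique : ∀ {A} k → Unique A → Unique (wordsOver A k)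
wordsOver-unique zero u = [] ∷ []
wordsOver-unique {A} (suc k) u = subst Unique (sym (wordsOver≡ A k))
  (Uniqueₚ.cartesianProductWith⁺ _∷_ Listₚ.∷-injective u (wordsOver-unique k u))

∈-wordsOver⁺ : ∀ {A} σ → All (_∈ A) σ → σ ∈ wordsOver A (length σ)
∈-wordsOver⁺ [] [] = here refl
∈-wordsOver⁺ {A} (a ∷ σ) (a∈ ∷ σ∈) = subst (a ∷ σ ∈_) (sym (wordsOver≡ A (length σ)))
  (∈-cartesianProductWith⁺ _∷_ a∈ (∈-wordsOver⁺ σ σ∈))

∈-wordsOver⁻ : ∀ {A σ} k → σ ∈ wordsOver A k → length σ ≡ k × All (_∈ A) σ
∈-wordsOver⁻ zero (here refl) = refl , []
∈-wordsOver⁻ {A} {σ} (suc k) σ∈ with ∈-cartesianProductWith⁻ _∷_ A (wordsOver A k) (subst (σ ∈_) (wordsOver≡ A k) σ∈)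
... | a , τ , a∈ , τ∈ , refl = let l , r = ∈-wordsOver⁻ k τ∈ in cong suc l , a∈ ∷ r

any-≡ᵇ-false : ∀ {x} xs → All (x ≢_) xs → any (λ y → x ≡ᵇ y) xs ≡ false
any-≡ᵇ-false [] [] = refl
any-≡ᵇ-false (a ∷ xs) (x≢a ∷ x≢) rewrite ≡ᵇ-false x≢a = any-≡ᵇ-false xs x≢

any-≡ᵇ-false⁻ : ∀ {x} xs → Bool.T (not (any (λ y → x ≡ᵇ y) xs)) → All (x ≢_) xs
any-≡ᵇ-false⁻ [] _ = []
any-≡ᵇ-false⁻ {x} (a ∷ xs) t with x ≡ᵇ a in eq
... | false = (λ { refl → subst Bool.T (trans (sym (≡ᵇ-refl x)) eq) _ }) ∷ any-≡ᵇ-false⁻ xs t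

Unique⇒distinct : ∀ {σ} → Unique σ → Bool.T (distinct σ)
Unique⇒distinct [] = _
Unique⇒distinct {x ∷ xs} (x≢ ∷ u) rewrite any-≡ᵇ-false xs x≢ = Unique⇒distinct u

distinct⇒Unique : ∀ σ → Bool.T (distinct σ) → Unique σ
distinct⇒Unique [] _ = []
distinct⇒Unique (x ∷ xs) t with any (λ y → x ≡ᵇ y) xs in eq
... | false = any-≡ᵇ-false⁻ xs (subst (Bool.T ∘ not) (sym eq) _) ∷ distinct⇒Unique xs t

perms-unique : ∀ n → Unique (perms n)
perms-unique n = Uniqueₚ.filter⁺ (T? ∘ distinct) (wordsOver-unique n (oneToN-unique n))

∈-perms⇒IsPerm : ∀ {n σ} → σ ∈ perms n → IsPerm n σ
∈-perms⇒IsPerm {n} {σ} σ∈ =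
  let σ∈w , d = ∈-filter⁻ (T? ∘ distinct) {xs = wordsOver (oneToN n) n} σ∈
      l , r = ∈-wordsOver⁻ n σ∈w
  in isPerm (distinct⇒Unique σ d) (All.map (All.lookup (oneToN-bounds n)) r) l

IsPerm⇒∈-perms : ∀ {n σ} → IsPerm n σ → σ ∈ perms n
IsPerm⇒∈-perms {n} {σ} p = ∈-filter⁺ (T? ∘ distinct)
  (subst (λ k → σ ∈ wordsOver (oneToN n) k) (size p) (∈-wordsOver⁺ σ (All.map (uncurry (∈-oneToN n)) (entries p))))
  (Unique⇒distinct (unique p))

T≡ext : ∀ n t → T n t ≡ length (filterᵇ (λ π → tier π ≡ᵇ t) (ext n 0 []))
T≡ext n t = Unique-length-filterᵇ _ (perms-unique n) (ext-unique n 0 [] refl)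
  (IsPerm⇒∈-ext-[] ∘ ∈-perms⇒IsPerm {n})
  (IsPerm⇒∈-perms ∘ ∈-ext⇒IsPerm n 0 [] [] refl (ℕₚ.+-identityʳ n))

-- Counting by tier

tierCount : ℕ → List (List ℕ) → ℚ
tierCount t L = fromℕℚ (length (filterᵇ (λ π → tier π ≡ᵇ t) L))

tierCount-++ : ∀ t L M → tierCount t (L ++ M) ≡ tierCount t L ℚ.+ tierCount t M
tierCount-++ t L M = trans
  (cong fromℕℚ (trans (cong length (Listₚ.filter-++ (T? ∘ λ π → tier π ≡ᵇ t) L M))
    (Listₚ.length-++ (filterᵇ (λ π → tier π ≡ᵇ t) L))))
  (fromℕℚ-+ (length (filterᵇ (λ π → tier π ≡ᵇ t) L)) _)

tierCount-gather : ∀ t k F → tierCount t (gather k F) ≡ ℚΣ.Σ≤ k (λ i → tierCount t (F i))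
tierCount-gather t zero F = refl
tierCount-gather t (suc k) F = trans (tierCount-++ t (gather k F) (F (suc k)))
  (cong (ℚ._+ tierCount t (F (suc k))) (tierCount-gather t k F))

w^-coefficient : ∀ c t → (GF.w GF.^ c) t ≡ (if c ≡ᵇ t then 1ℚ else 0ℚ)
w^-coefficient zero zero = refl
w^-coefficient zero (suc t) = refl
w^-coefficient (suc c) zero = ℚₚ.*-zeroˡ ((GF.w GF.^ c) 0)
w^-coefficient (suc c) (suc t) = trans (GF.w-⋆-suc (GF.w GF.^ c) t) (w^-coefficient c t)

tierCount-singleton : ∀ t π → tierCount t (π ∷ []) ≡ (if tier π ≡ᵇ t then 1ℚ else 0ℚ)
tierCount-singleton t π with tier π ≡ᵇ t
... | true = refl
... | false = refl

-- `ext` and `insertionGF` branch over the same places, and `insert-min` makes the cost index follow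
-- the state of the list; at the leaves the cost is the tier.
tierCount-ext : ∀ n {k p c π} t → State (suc n) k p c π → tierCount t (ext n k π) ≡ GF.insertionGF n k p c t
tierCount-ext zero {c = c} {π} t s = begin
  tierCount t (π ∷ [])              ≡⟨ tierCount-singleton t π ⟩
  (if tier π ≡ᵇ t then 1ℚ else 0ℚ)  ≡⟨ cong (λ m → if m ≡ᵇ t then 1ℚ else 0ℚ) (State⇒tier s refl) ⟩
  (if c ≡ᵇ t then 1ℚ else 0ℚ)       ≡⟨ w^-coefficient c t ⟨
  (GF.w GF.^ c) t                     ∎
  where open ≡-Reasoning
tierCount-ext (suc n) {k} {p} {c} {π} t s = begin
  tierCount t (gather k (λ i → ext n (suc k) (ins i (suc n) π)))
    ≡⟨ tierCount-gather t k _ ⟩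
  ℚΣ.Σ≤ k (λ i → tierCount t (ext n (suc k) (ins i (suc n) π)))
    ≡⟨ ℚΣ.Σ≤-cong k (λ i i≤k → tierCount-ext n t (insert-min s i i≤k)) ⟩
  ℚΣ.Σ≤ k (λ i → GF.insertionGF n (suc k) (suc i) (if i ≤ᵇ p then c else suc c) t)
    ≡⟨ GF.Σ≤-apply k _ t ⟨
  GF.insertionGF (suc n) k p c t ∎
  where open ≡-Reasoning

theorem4p12 : (n t : ℕ) → Tgf n t ≡ wSum term n t
theorem4p12 zero t = sym (wSum-term-0 t)
theorem4p12 (suc n) t = begin
  fromℕℚ (T (suc n) t)          ≡⟨ cong fromℕℚ (T≡ext (suc n) t) ⟩
  tierCount t (ext (suc n) 0 [])     ≡⟨ tierCount-ext (suc n) t empty ⟩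
  GF.insertionGF (suc n) 0 0 0 t                ≡⟨ wSum-term-suc n t ⟨
  wSum term (suc n) t                ∎
  where open ≡-Reasoning
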